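{- Let $H$ be a graph with $\chi(H)=r\ge 3$ and let $v(H)$ denote its number of vertices. Then $$\delta_{\mathrm{VC}}(H)\ \ge\ \frac{(r-3)(v(H)-1)+1}{(r-2)(v(H)-1)+1}\ >\ \frac{r-3}{r-2}.$$
   Context: All graphs are finite and simple. A graph is $H$-free if it contains no (not necessarily induced) subgraph isomorphic to $H$; it is maximal $H$-free if it is $H$-free and adding any missing edge creates a copy of $H$. $\delta(G)$ denotes minimum degree and $\chi$ the chromatic number. The VC-dimension $\mathrm{VC}(G)$ of a graph $G$ is the VC-dimension of the set system $\{N_G(v):v\in V(G)\}$ on $V(G)$, i.e. the maximum size of a set $S\subseteq V(G)$ such that $\{N_G(v)\cap S: v\in V(G)\}=2^S$. The VC-dimension threshold $\delta_{\mathrm{VC}}(H)$ is the infimum of all $\gamma\ge 0$ for which there exists a constant $C=C(\gamma,H)$ such that every maximal $H$-free graph $G$ with $\delta(G)\ge\gamma|V(G)|$ satisfies $\mathrm{VC}(G)\le C$. -}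

module Defs where

open import Level using (Level; 0ℓ) renaming (suc to lsuc)
open import Data.Bool.Properties using () renaming (_≟_ to _≟ᵇ_)
open import Data.Nat as ℕ using (ℕ; suc; s≤s; NonZero)
import Data.Nat.Properties as ℕ
open import Data.Integer using (+_)
open import Data.Rational as ℚ using (ℚ; 0ℚ)
import Data.Rational.Properties as ℚ
open import Data.Fin using (Fin)
import Data.Fin.Properties as Fin
open import Data.Fin.Subset using (Subset; ∣_∣; _∩_; _⊆_)
open import Data.Fin.Subset.Properties using (anySubset?; _⊆?_)
open import Data.List using (map; filter; allFin; upTo)
open import Data.List.Extrema.Nat using (min; max)
open import Data.Vec using (tabulate)
open import Data.Vec.Properties using (≡-dec)
open import Data.Product using (Σ; ∃; _×_; _,_)
open import Data.Sum using (_⊎_; inj₁; inj₂)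
open import Function using (_∘_; Injective)
open import Relation.Binary using (Rel; Decidable; Symmetric; Irreflexive)
open import Relation.Binary.PropositionalEquality using (_≡_; _≢_; refl; trans; sym)
open import Relation.Nullary using (¬_; Dec; does; ¬?; _×-dec_; _⊎-dec_)
open import Relation.Nullary.Decidable using (map′; decidable-stable)

private variable
  a b : Level
  m n : ℕ

-- Two-sided Dedekind cuts: L x q is q < x and U x q is x < q.
record ℝ : Set₁ where
  field
    L U         : ℚ → Set
    L-inhabited : ∃ L
    U-inhabited : ∃ U
    L-closed    : ∀ {p q} → p ℚ.< q → L q → L p
    U-closed    : ∀ {p q} → p ℚ.< q → U p → U q
    L-open      : ∀ {p} → L p → ∃ λ q → p ℚ.< q × L q
    U-open      : ∀ {q} → U q → ∃ λ p → p ℚ.< q × U p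
    disjoint    : ∀ {q} → L q → ¬ U q
    located     : ∀ {p q} → p ℚ.< q → L p ⊎ U q

-- A real (or ±∞) given only by the set of rationals strictly above it.
-- Classically this set determines the number; constructively these numbers,
-- unlike the Dedekind reals, have all infima.
record UpperReal (a : Level) : Set (lsuc a) where
  field
    U        : ℚ → Set a
    U-closed : ∀ {p q} → p ℚ.< q → U p → U q
    U-open   : ∀ {q} → U q → ∃ λ p → p ℚ.< q × U p

infix 4 _≤ᵁ_

_≤ᵁ_ : UpperReal a → UpperReal b → Set _
x ≤ᵁ y = ∀ q → UpperReal.U y q → UpperReal.U x q

fromℚ : ℚ → UpperReal 0ℓ
fromℚ r = record
  { U        = r ℚ.<_
  ; U-closed = λ p<q r<p → ℚ.<-trans r<p p<q
  ; U-open   = λ r<q → let p , r<p , p<q = ℚ.<-dense r<q in p , p<q , r<p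
  }

fromℝ : ℝ → UpperReal 0ℓ
fromℝ x = record { U = U ; U-closed = U-closed ; U-open = U-open }
  where open ℝ x

inf : (ℝ → Set₁) → UpperReal (lsuc 0ℓ)
inf S = record
  { U        = λ q → Σ ℝ λ x → S x × ℝ.U x q
  ; U-closed = λ { p<q (x , x∈S , x<p) → x , x∈S , ℝ.U-closed x p<q x<p }
  ; U-open   = λ { (x , x∈S , x<q) → let p , p<q , x<p = ℝ.U-open x x<q
                                     in p , p<q , x , x∈S , x<p }
  }

infix 4 _·_≤ℕ_

-- x·n ≤ d for natural numbers n and d: for n > 0 it says x ≤ d/n, i.e. every
-- rational q < x has q ≤ d/n; for n = 0 it says 0 ≤ d.
_·_≤ℕ_ : ℝ → ℕ → ℕ → Set
x · n ≤ℕ d = ∀ q → ℝ.L x q → q ℚ.* (+ n ℚ./ 1) ℚ.≤ + d ℚ./ 1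

record Graph (n : ℕ) : Set₁ where
  field
    Adj    : Rel (Fin n) 0ℓ
    adj?   : Decidable Adj
    symm   : Symmetric Adj
    irrefl : Irreflexive _≡_ Adj

open Graph public

N : Graph n → Fin n → Subset n
N G v = tabulate (does ∘ adj? G v)

degree : Graph n → Fin n → ℕ
degree G v = ∣ N G v ∣

-- n is only the value of the minimum over the empty list (degrees are < n);
-- the null graph gets minimum degree 0.
δ : Graph n → ℕ
δ {n} G = min n (map (degree G) (allFin n))

Colourable : Graph n → ℕ → Set
Colourable {n} G k =
  Σ (Fin n → Fin k) λ c → ∀ {u v} → Adj G u v → c u ≢ c v

record ChromaticNumber (G : Graph n) (r : ℕ) : Set where
  field
    colourable : Colourable G r
    least      : ∀ k → Colourable G k → r ℕ.≤ k

Contains : Graph m → Graph n → Set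
Contains {m} {n} H G =
  Σ (Fin m → Fin n) λ f →
    Injective _≡_ _≡_ f × (∀ {u v} → Adj H u v → Adj G (f u) (f v))

Free : Graph m → Graph n → Set
Free H G = ¬ Contains H G

addEdge : (G : Graph n) {u v : Fin n} → u ≢ v → Graph n
addEdge G {u} {v} u≢v = record
  { Adj    = λ x y → Adj G x y ⊎ (x ≡ u × y ≡ v) ⊎ (x ≡ v × y ≡ u)
  ; adj?   = λ x y → adj? G x y ⊎-dec ((x Fin.≟ u ×-dec y Fin.≟ v)
                                 ⊎-dec (x Fin.≟ v ×-dec y Fin.≟ u))
  ; symm   = λ { (inj₁ xy)              → inj₁ (symm G xy)
               ; (inj₂ (inj₁ (xu , yv))) → inj₂ (inj₂ (yv , xu))
               ; (inj₂ (inj₂ (xv , yu))) → inj₂ (inj₁ (yu , xv)) }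
  ; irrefl = λ { x≡y (inj₁ xy)               → irrefl G x≡y xy
               ; refl (inj₂ (inj₁ (xu , xv))) → u≢v (trans (sym xu) xv)
               ; refl (inj₂ (inj₂ (xv , xu))) → u≢v (trans (sym xu) xv) }
  }

record MaximalFree (H : Graph m) (G : Graph n) : Set where
  field
    free    : Free H G
    maximal : ∀ {u v} (u≢v : u ≢ v) → ¬ Adj G u v → Contains H (addEdge G u≢v)

-- { N(v) ∩ S : v ∈ V } = 2^S, of which the inclusion ⊆ always holds.
Shattered : Graph n → Subset n → Set
Shattered G S = ∀ T → T ⊆ S → ∃ λ v → N G v ∩ S ≡ T

shattered? : (G : Graph n) (S : Subset n) → Dec (Shattered G S)
shattered? {n} G S = map′ to from (¬? (anySubset? λ T → T ⊆? S ×-dec ¬? (trace? T)))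
  where
  Trace : Subset n → Set
  Trace T = ∃ λ v → N G v ∩ S ≡ T

  trace? : ∀ T → Dec (Trace T)
  trace? T = Fin.any? λ v → ≡-dec _≟ᵇ_ (N G v ∩ S) T

  to : ¬ (∃ λ T → T ⊆ S × ¬ Trace T) → Shattered G S
  to none T T⊆S = decidable-stable (trace? T) λ ¬tr → none (T , T⊆S , ¬tr)

  from : Shattered G S → ¬ (∃ λ T → T ⊆ S × ¬ Trace T)
  from sh (T , T⊆S , ¬tr) = ¬tr (sh T T⊆S)

ShatteredSize : Graph n → ℕ → Set
ShatteredSize G k = ∃ λ S → ∣ S ∣ ≡ k × Shattered G S

shatteredSize? : (G : Graph n) (k : ℕ) → Dec (ShatteredSize G k)
shatteredSize? G k = anySubset? λ S → ∣ S ∣ ℕ.≟ k ×-dec shattered? G S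

-- The null graph, which shatters no set at all, gets the value 0.
VC : Graph n → ℕ
VC {n} G = max 0 (filter (shatteredSize? G) (upTo (suc n)))

BoundsVC : Graph m → ℝ → Set₁
BoundsVC H γ =
  ∃ λ C → ∀ {n} (G : Graph n) → MaximalFree H G → γ · n ≤ℕ δ G → VC G ℕ.≤ C

δVC : Graph m → UpperReal (lsuc 0ℓ)
δVC H = inf λ γ → fromℚ 0ℚ ≤ᵁ fromℝ γ × BoundsVC H γ

r∸2-nonZero : ∀ {r} → 3 ℕ.≤ r → NonZero (r ℕ.∸ 2)
r∸2-nonZero (s≤s (s≤s (s≤s _))) = _

{-# OPTIONS --safe #-}

-- A proper partial colouring c of H with r ∸ 3 colours leaves an uncoloured core, which is not
-- bipartite. Let g be the largest odd girth of a core. Among the cores of odd girth g choose one,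
-- M, with a smallest set x ∷ L of vertices meeting all its odd cycles of length g.
--
-- The graph G₀ is the join of r ∸ 3 large independent classes and a graph that maps to M: single
-- vertices w z for z ∈ L ("hubs"), d copies q j of M minus x and L, and for each word T of length d
-- over V(H) a vertex s T, a partial copy of x that sees in the j-th copy only the vertex T j;
-- to reach the minimum degree, there is one large cluster for each z, joined to the copies of z,
-- and the clusters span a bipartite graph. Outside the large classes G₀ has odd girth at least g,
-- and greater than g after deleting the hubs: a vertex s T has only one neighbour in each copy, and
-- a cycle using a cluster becomes shorter in M. By minimality of x ∷ L, G₀ is H-free.
--
-- In a maximal H-free extension of G₀ every s T misses, in every copy, some neighbour of x (else the
-- two complete a copy of H), but not T j. So the trace of s T on the copies is compatible with at
-- most (v(H) ∸ 1) ^ d words, and there are exponentially many traces on the d * v(H) vertices of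
-- the copies. By the Sauer–Shelah lemma the VC-dimension is unbounded as d grows.

module Submission where

open import Level using (Level; 0ℓ)
open import Data.Bool using (Bool; true; false; not; _xor_)
import Data.Bool.Properties as Bool
open import Data.Empty using (⊥)
open import Data.Unit using (⊤; tt)
open import Data.Nat using (ℕ; zero; suc; _+_; _*_; _∸_; _^_; _≤_; _<_; z≤n; s≤s; _≤?_; NonZero)
open import Data.Nat.Induction using (<-rec)
import Data.Nat.Properties as ℕ
open import Data.Nat.Tactic.RingSolver using (solve-∀)
open import Data.Integer as ℤ using (ℤ; +_; -[1+_])
import Data.Integer.Properties as ℤ
import Data.Integer.Tactic.RingSolver as ℤRing
open import Data.Rational as ℚ using (_/_; toℚᵘ)
import Data.Rational.Properties as ℚ
open import Data.Rational.Unnormalised as ℚᵘ using (mkℚᵘ)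
import Data.Rational.Unnormalised.Properties as ℚᵘ
open import Data.Fin using (Fin; zero; suc; finToFun; funToFin; remQuot; combine; inject≤)
import Data.Fin.Properties as Fin
import Data.Fin.Subset as Sub
open import Data.Fin.Subset using (Subset; inside; outside; _⊆_; _∩_; _∪_; ∣_∣; ⁅_⁆; _-_)
import Data.Fin.Subset.Properties as Subₚ
open import Data.List using (List; []; _∷_; _++_; map; filter; foldr; length; allFin; cartesianProduct)
open import Data.List.Extrema.Nat using (xs≤max; v≤min⁺)
import Data.List.Membership.DecPropositional as DecMembership
open import Data.List.Membership.Propositional using (_∈_; _∉_)
open import Data.List.Membership.Propositional.Properties
  using (∈-allFin; ∈-cartesianProduct⁺; ∈-map⁺; ∈-map⁻; ∈-++⁺ˡ; ∈-++⁺ʳ; ∈-filter⁺; ∈-filter⁻; ∈-upTo⁺)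
open import Data.List.Properties using (length-map; length-++; length-tabulate; length-filter)
import Data.List.Relation.Unary.All as All
import Data.List.Relation.Unary.All.Properties as All
open import Data.List.Relation.Unary.Any using (here; there)
open import Data.Maybe using (Maybe; just; nothing)
import Data.Maybe.Properties as Maybe
open import Data.Product using (Σ; ∃; _×_; _,_; proj₁; proj₂)
open import Data.Sum using (_⊎_; inj₁; inj₂)
open import Data.Sum.Function.Propositional using (_⊎-↔_)
open import Data.Vec using (Vec; []; _∷_; here; there; lookup; tabulate; replicate)
import Data.Vec.Properties as Vec
open import Function using (_∘_; id; Injective; _↔_; Inverse; Injection)
open import Function.Properties.Inverse using (↔-refl; ↔-sym; ↔-trans; ↔⇒↣)
open import Relation.Binary using (Rel; Symmetric; Decidable; tri<; tri≈; tri>)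
open import Relation.Binary.PropositionalEquality
open import Relation.Nullary using (¬_; Dec; yes; no; does; contradiction; ¬?; _×-dec_; _⊎-dec_)
open import Relation.Nullary.Decidable using (¬¬-excluded-middle; decidable-stable; dec-true)
open import Defs

private variable
  ℓ ℓ' : Level

-- Classical reasoning under double negation

infixl 1 _>>=_

-- The bound to be proved is a decidable inequality of rationals, so the argument may run by
-- contradiction, with excluded middle available inside this monad.
_>>=_ : {A : Set ℓ} {B : Set ℓ'} → ¬ ¬ A → (A → ¬ ¬ B) → ¬ ¬ B
(m >>= f) k = m λ x → f x k

return : {A : Set ℓ} → A → ¬ ¬ A
return x k = k x

¬¬-∀Fin : ∀ {n} {P : Fin n → Set ℓ} → (∀ i → ¬ ¬ P i) → ¬ ¬ (∀ i → P i)
¬¬-∀Fin {n = zero}  f = return λ ()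
¬¬-∀Fin {n = suc n} f = do
  p  ← f zero
  ps ← ¬¬-∀Fin (f ∘ suc)
  return λ { zero → p ; (suc i) → ps i }

¬¬-least : (P : ℕ → Set) → ∀ n → P n → ¬ ¬ ∃ λ m → P m × (∀ j → j < m → ¬ P j)
¬¬-least P = <-rec (λ n → P n → ¬ ¬ ∃ λ m → P m × (∀ j → j < m → ¬ P j)) λ n rec Pn → do
  no none ← ¬¬-excluded-middle {A = ∃ λ j → j < n × P j}
    where yes (j , j<n , Pj) → rec j<n Pj
  return (n , Pn , λ j j<n Pj → none (j , j<n , Pj))

-- By monotonicity the sum of the individual bounds serves as a common one.
¬¬-bound-Fin : ∀ {m} (P : Fin m → ℕ → Set) → (∀ i {g g'} → g ≤ g' → P i g → P i g') →
  (∀ i → ¬ ¬ ∃ (P i)) → ¬ ¬ ∃ λ g → ∀ i → P i g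
¬¬-bound-Fin {zero}  P mono ex = return (0 , λ ())
¬¬-bound-Fin {suc m} P mono ex = do
  g , p  ← ex zero
  g' , q ← ¬¬-bound-Fin (P ∘ suc) (λ i → mono (suc i)) (ex ∘ suc)
  return (g + g' , λ { zero    → mono zero (ℕ.m≤m+n g g') p
                     ; (suc i) → mono (suc i) (ℕ.m≤n+m g' g) (q i) })

-- Meant for partial colourings, which are vectors over a finite set: a bound for each of them
-- becomes a uniform one.
¬¬-bound-Vec : ∀ {A : Set} {m} (e : Fin m → A) → (∀ x → ∃ λ i → e i ≡ x) →
  ∀ {n} (P : Vec A n → ℕ → Set) → (∀ v {g g'} → g ≤ g' → P v g → P v g') →
  (∀ v → ¬ ¬ ∃ (P v)) → ¬ ¬ ∃ λ g → ∀ v → P v g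
¬¬-bound-Vec e onto {zero}  P mono ex = do
  g , p ← ex []
  return (g , λ { [] → p })
¬¬-bound-Vec e onto {suc n} P mono ex = do
  g , p ← ¬¬-bound-Fin (λ i g → ∀ v → P (e i ∷ v) g) (λ i g≤g' p v → mono _ g≤g' (p v))
            λ i → ¬¬-bound-Vec e onto (P ∘ (e i ∷_)) (λ v → mono _) (λ v → ex (e i ∷ v))
  return (g , λ { (x ∷ v) → let i , eq = onto x in subst (λ y → P (y ∷ v) g) eq (p i v) })

-- Odd closed walks

data Walk {A : Set} (R : Rel A 0ℓ) : A → A → ℕ → Set where
  []  : ∀ {u} → Walk R u u 0
  _∷_ : ∀ {u v w n} → R u v → Walk R v w n → Walk R u w (suc n)

module _ {A : Set} {R : Rel A 0ℓ} where

  infixr 5 _++ʷ_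

  _++ʷ_ : ∀ {u v w m n} → Walk R u v m → Walk R v w n → Walk R u w (m + n)
  []      ++ʷ q = q
  (e ∷ p) ++ʷ q = e ∷ (p ++ʷ q)

  mapʷ : ∀ {B : Set} {R' : Rel B 0ℓ} (f : A → B) → (∀ {u v} → R u v → R' (f u) (f v)) →
    ∀ {u v n} → Walk R u v n → Walk R' (f u) (f v) n
  mapʷ f hom []      = []
  mapʷ f hom (e ∷ p) = hom e ∷ mapʷ f hom p

  reverseʷ : Symmetric R → ∀ {u v n} → Walk R u v n → Walk R v u n
  reverseʷ sy []      = []
  reverseʷ sy (_∷_ {n = n} e p) =
    subst (Walk R _ _) (ℕ.+-comm n 1) (reverseʷ sy p ++ʷ (sy e ∷ []))

odd : ℕ → Bool
odd zero    = false
odd (suc n) = not (odd n)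

odd-+ : ∀ m n → odd (m + n) ≡ odd m xor odd n
odd-+ zero    n = refl
odd-+ (suc m) n rewrite odd-+ m n with odd m
... | true  = Bool.not-involutive (odd n)
... | false = refl

-- Odd girth greater than `g`: in a graph a shortest odd closed walk is a cycle, and walks, unlike
-- cycles, are preserved by homomorphisms.
NoOdd : {A : Set} → Rel A 0ℓ → ℕ → Set
NoOdd R g = ∀ u n → n ≤ g → odd n ≡ true → ¬ Walk R u u n

-- The vertices of `L` stay as isolated ones, so the vertex type does not change.
Del : {A : Set} → Rel A 0ℓ → List A → Rel A 0ℓ
Del R L u v = R u v × u ∉ L × v ∉ L

NoOdd-antitone : {A : Set} {R : Rel A 0ℓ} → ∀ {g g'} → g ≤ g' → NoOdd R g' → NoOdd R g
NoOdd-antitone g≤g' noOdd u n n≤g = noOdd u n (ℕ.≤-trans n≤g g≤g')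

module _ {n : ℕ} (R : Rel (Fin n) 0ℓ) (R-sym : Symmetric R) (noOdd : ∀ g → NoOdd R g) where

  private
    record Colouring (xs : List (Fin n)) : Set₁ where
      field
        κ      : Fin n → Bool
        D      : Fin n → Set
        covers : ∀ {u} → u ∈ xs → D u
        closed : ∀ {u v} → R u v → D u → D v
        proper : ∀ {u v} → R u v → D u → κ u ≢ κ v

    -- The component of `x` is added. Outside the old `D` a vertex is coloured by whether an odd
    -- walk from `x` reaches it: two adjacent vertices with such walks would give an odd closed walk
    -- at `x`, and a neighbour of an evenly reached vertex is oddly reached.
    extend : ∀ {x xs} → Colouring xs → ¬ ¬ Colouring (x ∷ xs)
    extend {x} {xs} C = do
      D?   ← ¬¬-∀Fin {P = λ u → Dec (D u)} λ u → ¬¬-excluded-middle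
      odd? ← ¬¬-∀Fin {P = λ u → Dec (OddReach u)} λ u → ¬¬-excluded-middle
      return (extended D? odd?)
      where
      open Colouring C

      OddReach : Fin n → Set
      OddReach u = ∃ λ m → odd m ≡ true × Walk R x u m

      Reach : Fin n → Set
      Reach u = ∃ λ m → Walk R x u m

      snoc : ∀ {u v m} → Walk R x u m → R u v → Walk R x v (suc m)
      snoc {m = m} p e = subst (Walk R _ _) (ℕ.+-comm m 1) (p ++ʷ (e ∷ []))

      extended : (∀ u → Dec (D u)) → (∀ u → Dec (OddReach u)) → Colouring (x ∷ xs)
      extended D? odd? = record
        { κ      = κ'
        ; D      = λ u → D u ⊎ Reach u
        ; covers = λ { (here refl) → inj₂ (0 , []) ; (there u∈xs) → inj₁ (covers u∈xs) }
        ; closed = λ { e (inj₁ Du) → inj₁ (closed e Du)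
                     ; e (inj₂ (m , p)) → inj₂ (suc m , snoc p e) }
        ; proper = proper'
        }
        where
        κ' : Fin n → Bool
        κ' u with D? u
        ... | yes _ = κ u
        ... | no  _ = does (odd? u)

        proper' : ∀ {u v} → R u v → D u ⊎ Reach u → κ' u ≢ κ' v
        proper' {u} {v} e r with D? u | D? v
        ... | yes Du | yes _   = proper e Du
        ... | yes Du | no ¬Dv  = contradiction (closed e Du) ¬Dv
        ... | no ¬Du | yes Dv  = contradiction (closed (R-sym e) Dv) ¬Du
        ... | no ¬Du | no _ with odd? u | odd? v
        ...   | yes _ | no _ = λ ()
        ...   | no _ | yes _ = λ ()
        ...   | yes (m , om , p) | yes (l , ol , q) = contradiction
                (p ++ʷ (e ∷ reverseʷ R-sym q)) (noOdd _ _ _ ℕ.≤-refl parity)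
          where
          parity : odd (m + suc l) ≡ true
          parity rewrite odd-+ m (suc l) | om | ol = refl
        ...   | no ¬ou | no ¬ov with r
        ...     | inj₁ Du = contradiction Du ¬Du
        ...     | inj₂ (m , p) with odd m in om
        ...       | true  = contradiction (m , om , p) ¬ou
        ...       | false = contradiction (suc m , cong not om , snoc p e) ¬ov

    colouring : ∀ xs → ¬ ¬ Colouring xs
    colouring []       = return record
      { κ = λ _ → true ; D = λ _ → ⊥ ; covers = λ () ; closed = λ _ () ; proper = λ _ () }
    colouring (x ∷ xs) = colouring xs >>= extend

  bipartite : ¬ ¬ ∃ λ (κ : Fin n → Bool) → ∀ {u v} → R u v → κ u ≢ κ v
  bipartite = do
    C ← colouring (allFin n)
    let open Colouring C
    return (κ , λ {u} {v} e → proper e (covers (∈-allFin u)))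

-- Greedy: a vertex joins the set exactly when it has no neighbour in it yet.
maximalIndependent : ∀ {n} (R : Rel (Fin n) 0ℓ) → Decidable R → Symmetric R → (∀ {u} → ¬ R u u) →
  ∃ λ (κ : Fin n → Bool) → (∀ {u v} → R u v → κ u ≡ true → κ v ≡ false) ×
                           (∀ u → κ u ≡ true ⊎ ∃ λ v → R u v × κ v ≡ true)
maximalIndependent {n} R R? R-sym R-irr =
  let κ , ind , dom = go (allFin n) in κ , ind , λ u → dom (∈-allFin u)
  where
  Dominated : (Fin n → Bool) → Fin n → Set
  Dominated κ u = κ u ≡ true ⊎ ∃ λ v → R u v × κ v ≡ true

  go : ∀ xs → ∃ λ (κ : Fin n → Bool) → (∀ {u v} → R u v → κ u ≡ true → κ v ≡ false) ×
                                       (∀ {u} → u ∈ xs → Dominated κ u)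
  go [] = (λ _ → false) , (λ _ ()) , λ ()
  go (x ∷ xs) with go xs
  ... | κ , ind , dom with Fin.any? (λ v → R? x v ×-dec (κ v Bool.≟ true))
  ...   | yes d = κ , ind , λ { (here refl) → inj₂ d ; (there u∈xs) → dom u∈xs }
  ...   | no ¬d = κ' , ind' , λ { (here refl) → inj₁ κ'x ; (there u∈xs) → mono (dom u∈xs) }
    where
    κ' : Fin n → Bool
    κ' u with u Fin.≟ x
    ... | yes _ = true
    ... | no  _ = κ u

    κ'x : κ' x ≡ true
    κ'x with x Fin.≟ x
    ... | yes _  = refl
    ... | no x≢x = contradiction refl x≢x

    up : ∀ u → κ u ≡ true → κ' u ≡ true
    up u κu with u Fin.≟ x
    ... | yes _ = refl
    ... | no  _ = κu

    mono : ∀ {u} → Dominated κ u → Dominated κ' u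
    mono (inj₁ κu)           = inj₁ (up _ κu)
    mono (inj₂ (v , e , κv)) = inj₂ (v , e , up v κv)

    off : ∀ {v} → R x v → κ v ≡ false
    off {v} e with κ v in κv
    ... | true  = contradiction (v , e , κv) ¬d
    ... | false = refl

    ind' : ∀ {u v} → R u v → κ' u ≡ true → κ' v ≡ false
    ind' {u} {v} e κ'u with u Fin.≟ x | v Fin.≟ x
    ... | yes refl | yes refl = contradiction e R-irr
    ... | yes refl | no _     = off e
    ... | no _     | yes refl = contradiction (trans (sym κ'u) (off (R-sym e))) λ ()
    ... | no _     | no _     = ind e κ'u

-- A maximal independent set and its complement both dominate the non-isolated vertices.
dominatingBipartition : ∀ {n} (R : Rel (Fin n) 0ℓ) → Decidable R → Symmetric R → (∀ {u} → ¬ R u u) →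
  ∃ λ (κ : Fin n → Bool) → ∀ {u v} → R u v → ∃ λ w → R u w × κ u ≢ κ w
dominatingBipartition R R? R-sym R-irr = κ , neighbour
  where
  κ   = proj₁ (maximalIndependent R R? R-sym R-irr)
  ind = proj₁ (proj₂ (maximalIndependent R R? R-sym R-irr))
  dom = proj₂ (proj₂ (maximalIndependent R R? R-sym R-irr))

  neighbour : ∀ {u v} → R u v → ∃ λ w → R u w × κ u ≢ κ w
  neighbour {u} {v} e with dom u
  ... | inj₁ κu            = v , e , λ eq → contradiction (trans (sym κu) (trans eq (ind e κu))) λ ()
  ... | inj₂ (w , e' , κw) = w , e' , λ eq →
          contradiction (trans (sym (trans eq κw)) (ind (R-sym e') κw)) λ ()

-- Maximal `H`-free extensions

Extends : ∀ {n} → Graph n → Graph n → Set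
Extends G₀ G = ∀ u v → Adj G₀ u v → Adj G u v

Contains-mono : ∀ {m n} {H : Graph m} {G G' : Graph n} → Extends G G' → Contains H G → Contains H G'
Contains-mono ext (f , inj , hom) = f , inj , λ e → ext _ _ (hom e)

-- The pairs are tried one after another, and an edge is added unless it creates a copy of `H`. A
-- refused edge stays refused, since copies survive in larger graphs.
maximalExtension : ∀ {m n} (H : Graph m) (G₀ : Graph n) → Free H G₀ →
  ¬ ¬ Σ (Graph n) λ G → Extends G₀ G × MaximalFree H G
maximalExtension {n = n} H G₀ free₀ = do
  G , ext , free , sat ← go (cartesianProduct (allFin n) (allFin n))
  return (G , ext , record
    { free    = free
    ; maximal = sat _ _ (∈-cartesianProduct⁺ (∈-allFin _) (∈-allFin _)) })
  where
  Saturated : Graph n → List (Fin n × Fin n) → Set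
  Saturated G ps = ∀ u v → (u , v) ∈ ps → (u≢v : u ≢ v) → ¬ Adj G u v → Contains H (addEdge G u≢v)

  addEdge-mono : ∀ {G G' : Graph n} {u v} (p q : u ≢ v) → Extends G G' →
    Extends (addEdge G p) (addEdge G' q)
  addEdge-mono p q ext _ _ (inj₁ e) = inj₁ (ext _ _ e)
  addEdge-mono p q ext _ _ (inj₂ e) = inj₂ e

  go : ∀ ps → ¬ ¬ Σ (Graph n) λ G → Extends G₀ G × Free H G × Saturated G ps
  go [] = return (G₀ , (λ _ _ e → e) , free₀ , λ _ _ ())
  go ((x , y) ∷ ps) = do
    G , ext , free , sat ← go ps
    no x≢y ← return (x Fin.≟ y)
      where yes x≡y → return (G , ext , free , λ
              { _ _ (here refl) x≢y _ → contradiction x≡y x≢y ; _ _ (there i) → sat _ _ i })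
    no new ← ¬¬-excluded-middle {A = Contains H (addEdge G x≢y)}
      where yes C → return (G , ext , free , λ
              { _ _ (here refl) q _ → Contains-mono {H = H} {addEdge G x≢y} {addEdge G q}
                                        (addEdge-mono {G} {G} x≢y q (λ _ _ e → e)) C
              ; _ _ (there i) → sat _ _ i })
    let G' = addEdge G x≢y
    return (G' , (λ _ _ e → inj₁ (ext _ _ e)) , new , λ
      { _ _ (here refl) q ¬e → contradiction (inj₂ (inj₁ (refl , refl))) ¬e
      ; _ _ (there i) q ¬e → Contains-mono {H = H} {addEdge G q} {addEdge G' q}
                               (addEdge-mono {G} {G'} q q (λ _ _ → inj₁))
                               (sat _ _ i q (λ e → ¬e (inj₁ e))) })

-- The Sauer–Shelah lemma and the number of words needed to cover all T

∣p∣-injection : ∀ {m n} (p : Subset n) (f : Fin m → Fin n) → Injective _≡_ _≡_ f →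
  (∀ i → f i Sub.∈ p) → m ≤ ∣ p ∣
∣p∣-injection {zero}  p f inj f∈p = z≤n
∣p∣-injection {suc m} p f inj f∈p = ℕ.≤-trans
  (s≤s (∣p∣-injection (p - f zero) (f ∘ suc) (λ eq → Fin.suc-injective (inj eq))
    λ i → Subₚ.x∈p∧x≢y⇒x∈p-y (f∈p (suc i)) λ eq → contradiction (inj eq) λ ()))
  (Subₚ.x∈p⇒∣p-x∣<∣p∣ (f∈p zero))

fromList : ∀ {n} → List (Fin n) → Subset n
fromList = foldr (λ x p → ⁅ x ⁆ ∪ p) Sub.⊥

∈-fromList : ∀ {n} {x : Fin n} {xs} → x ∈ xs → x Sub.∈ fromList xs
∈-fromList (here refl) = Subₚ.x∈p∪q⁺ (inj₁ (Subₚ.x∈⁅x⁆ _))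
∈-fromList (there x∈)  = Subₚ.x∈p∪q⁺ (inj₂ (∈-fromList x∈))

∣p∪q∣≤∣p∣+∣q∣ : ∀ {n} (p q : Subset n) → ∣ p ∪ q ∣ ≤ ∣ p ∣ + ∣ q ∣
∣p∪q∣≤∣p∣+∣q∣ []            []            = z≤n
∣p∪q∣≤∣p∣+∣q∣ (inside  ∷ p) (inside  ∷ q) =
  s≤s (ℕ.≤-trans (∣p∪q∣≤∣p∣+∣q∣ p q) (ℕ.+-monoʳ-≤ ∣ p ∣ (ℕ.n≤1+n ∣ q ∣)))
∣p∪q∣≤∣p∣+∣q∣ (inside  ∷ p) (outside ∷ q) = s≤s (∣p∪q∣≤∣p∣+∣q∣ p q)
∣p∪q∣≤∣p∣+∣q∣ (outside ∷ p) (inside  ∷ q) =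
  ℕ.≤-trans (s≤s (∣p∪q∣≤∣p∣+∣q∣ p q)) (ℕ.≤-reflexive (sym (ℕ.+-suc ∣ p ∣ ∣ q ∣)))
∣p∪q∣≤∣p∣+∣q∣ (outside ∷ p) (outside ∷ q) = ∣p∪q∣≤∣p∣+∣q∣ p q

∣fromList∣ : ∀ {n} (xs : List (Fin n)) → ∣ fromList xs ∣ ≤ length xs
∣fromList∣ {n} []   = ℕ.≤-reflexive (Subₚ.∣⊥∣≡0 n)
∣fromList∣ (x ∷ xs) = ℕ.≤-trans (∣p∪q∣≤∣p∣+∣q∣ ⁅ x ⁆ (fromList xs))
  (ℕ.+-mono-≤ (ℕ.≤-reflexive (Subₚ.∣⁅x⁆∣≡1 x)) (∣fromList∣ xs))

shattered≤VC : ∀ {n m} (G : Graph n) → ShatteredSize G m → m ≤ VC G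
shattered≤VC {n} {m} G sh@(S , ∣S∣≡m , _) = All.lookup (xs≤max 0 _)
  (∈-filter⁺ (shatteredSize? G) (∈-upTo⁺ (s≤s (subst (_≤ n) ∣S∣≡m (Subₚ.∣p∣≤n S)))) sh)

-- The Sauer–Shelah bound: the sum of the binomial coefficients n C i over i < c.
sauerBound : ℕ → ℕ → ℕ
sauerBound n       zero    = 0
sauerBound zero    (suc c) = 1
sauerBound (suc n) (suc c) = sauerBound n (suc c) + sauerBound n c

sauerBound≤^ : ∀ n c → sauerBound n c ≤ suc n ^ c
sauerBound≤^ n       zero    = z≤n
sauerBound≤^ zero    (suc c) = ℕ.≤-reflexive (sym (ℕ.^-zeroˡ (suc c)))
sauerBound≤^ (suc n) (suc c) = begin
  sauerBound n (suc c) + sauerBound n c  ≤⟨ ℕ.+-mono-≤ (sauerBound≤^ n (suc c)) (sauerBound≤^ n c) ⟩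
  suc n * suc n ^ c + suc n ^ c          ≡⟨ ℕ.+-comm (suc n * suc n ^ c) _ ⟩
  suc (suc n) * suc n ^ c                ≤⟨ ℕ.*-monoʳ-≤ (suc (suc n)) (ℕ.^-monoˡ-≤ c (ℕ.n≤1+n (suc n))) ⟩
  suc (suc n) ^ suc c                    ∎
  where open ℕ.≤-Reasoning

Shatters : ∀ {n} → (Subset n → Set) → Subset n → Set
Shatters P S = ∀ T → T ⊆ S → ∃ λ w → P w × w ∩ S ≡ T

private
  shatters-outside : ∀ {n} {P : Subset (suc n) → Set} {P' : Subset n → Set} →
    (∀ {w} → P' w → ∃ λ b → P (b ∷ w)) → ∀ {S} → Shatters P' S → Shatters P (outside ∷ S)
  shatters-outside lift sh (inside  ∷ T) T⊆S = contradiction (T⊆S here) λ ()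
  shatters-outside lift sh (outside ∷ T) T⊆S with sh T (Subₚ.drop-∷-⊆ T⊆S)
  ... | w , Pw , eq with lift Pw
  ...   | true  , Pbw = true  ∷ w , Pbw , cong (outside ∷_) eq
  ...   | false , Pbw = false ∷ w , Pbw , cong (outside ∷_) eq

  shatters-inside : ∀ {n} {P : Subset (suc n) → Set} {P' : Subset n → Set} →
    (∀ {w} → P' w → ∀ b → P (b ∷ w)) → ∀ {S} → Shatters P' S → Shatters P (inside ∷ S)
  shatters-inside lift sh (true ∷ T) T⊆S with sh T (Subₚ.drop-∷-⊆ T⊆S)
  ... | w , Pw , eq = true ∷ w , lift Pw true , cong (true ∷_) eq
  shatters-inside lift sh (false ∷ T) T⊆S with sh T (Subₚ.drop-∷-⊆ T⊆S)
  ... | w , Pw , eq = false ∷ w , lift Pw false , cong (false ∷_) eq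

-- When the first element of `A` is dropped, two families arise: the projections, and the sets both
-- of whose extensions satisfy `P`. A set shattered by the former is shattered by `P`; one shattered
-- by the latter remains so with the dropped element added. Otherwise the lengths of the two lists
-- add up as in Pascal's rule.
sauerShelah : ∀ {n} (A : Subset n) c {P : Subset n → Set} → (∀ w → Dec (P w)) →
  (∀ {w} → P w → w ⊆ A) →
  (∃ λ S → ∣ S ∣ ≡ c × Shatters P S) ⊎
  (∃ λ ws → length ws ≤ sauerBound ∣ A ∣ c × (∀ {w} → P w → w ∈ ws))
sauerShelah {n} A zero P? P⊆A with Subₚ.anySubset? P?
... | yes (w , Pw) = inj₁ (Sub.⊥ , Subₚ.∣⊥∣≡0 n , λ T T⊆⊥ →
        w , Pw , trans (Subₚ.∩-zeroʳ w) (sym (Subₚ.⊆-antisym T⊆⊥ (Subₚ.⊆-min T))))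
... | no none = inj₂ ([] , z≤n , λ Pw → contradiction (_ , Pw) none)
sauerShelah [] (suc c) P? P⊆A = inj₂ ([] ∷ [] , s≤s z≤n , λ { {[]} _ → here refl })
sauerShelah (outside ∷ A) (suc c) {P} P? P⊆A
  with sauerShelah A (suc c) (P? ∘ (outside ∷_)) (Subₚ.drop-∷-⊆ ∘ P⊆A)
... | inj₁ (S , ∣S∣ , sh) = inj₁ (outside ∷ S , ∣S∣ , shatters-outside (outside ,_) sh)
... | inj₂ (ws , len , all) = inj₂ (map (outside ∷_) ws , subst (_≤ _) (sym (length-map _ ws)) len ,
        λ { {inside ∷ w} Pw → contradiction (P⊆A Pw here) λ ()
          ; {outside ∷ w} Pw → ∈-map⁺ _ (all Pw) })
sauerShelah {suc n} (inside ∷ A) (suc c) {P} P? P⊆A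
  with sauerShelah A (suc c) {λ w → P (inside ∷ w) ⊎ P (outside ∷ w)}
         (λ w → P? (inside ∷ w) ⊎-dec P? (outside ∷ w))
         (λ { (inj₁ Pw) → Subₚ.drop-∷-⊆ (P⊆A Pw) ; (inj₂ Pw) → Subₚ.drop-∷-⊆ (P⊆A Pw) })
... | inj₁ (S , ∣S∣ , sh) = inj₁ (outside ∷ S , ∣S∣ ,
        shatters-outside (λ { (inj₁ Pw) → inside , Pw ; (inj₂ Pw) → outside , Pw }) sh)
... | inj₂ (us , lenᵘ , allᵘ)
  with sauerShelah A c {λ w → P (inside ∷ w) × P (outside ∷ w)}
         (λ w → P? (inside ∷ w) ×-dec P? (outside ∷ w)) (Subₚ.drop-∷-⊆ ∘ P⊆A ∘ proj₁)
...   | inj₁ (S , ∣S∣ , sh) = inj₁ (inside ∷ S , cong suc ∣S∣ ,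
          shatters-inside (λ { (Pi , Po) true → Pi ; (Pi , Po) false → Po }) sh)
...   | inj₂ (vs , lenᵛ , allᵛ) = inj₂ (map first us ++ map (outside ∷_) vs , len , all)
  where
  -- Each projection accounts for one extension, the `inside` one if present; when both are present,
  -- `vs` supplies the `outside` one.
  first : Subset n → Subset (suc n)
  first w = does (P? (inside ∷ w)) ∷ w

  len : length (map first us ++ map (outside ∷_) vs) ≤ sauerBound (suc ∣ A ∣) (suc c)
  len = ℕ.≤-trans
    (ℕ.≤-reflexive (trans (length-++ (map first us)) (cong₂ _+_ (length-map first us) (length-map _ vs))))
    (ℕ.+-mono-≤ lenᵘ lenᵛ)

  all : ∀ {w} → P w → w ∈ map first us ++ map (outside ∷_) vs
  all {inside ∷ w} Pw with P? (inside ∷ w) in eq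
  ... | yes _ = ∈-++⁺ˡ (subst (λ b → b ∷ w ∈ map first us) (cong does eq)
                  (∈-map⁺ first (allᵘ (inj₁ Pw))))
  ... | no ¬p = contradiction Pw ¬p
  all {outside ∷ w} Pw with P? (inside ∷ w) in eq
  ... | yes p = ∈-++⁺ʳ (map first us) (∈-map⁺ _ (allᵛ (p , Pw)))
  ... | no _  = ∈-++⁺ˡ (subst (λ b → b ∷ w ∈ map first us) (cong does eq)
                  (∈-map⁺ first (allᵘ (inj₂ Pw))))

ΣFin : ∀ {n} → (Fin n → ℕ) → ℕ
ΣFin {zero}  f = 0
ΣFin {suc n} f = f zero + ΣFin (f ∘ suc)

ΣFin-mono : ∀ {n} {f g : Fin n → ℕ} → (∀ i → f i ≤ g i) → ΣFin f ≤ ΣFin g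
ΣFin-mono {zero}  f≤g = z≤n
ΣFin-mono {suc n} f≤g = ℕ.+-mono-≤ (f≤g zero) (ΣFin-mono (f≤g ∘ suc))

ΣFin-+ : ∀ {n} (f g : Fin n → ℕ) → ΣFin (λ i → f i + g i) ≡ ΣFin f + ΣFin g
ΣFin-+ {zero}  f g = refl
ΣFin-+ {suc n} f g rewrite ΣFin-+ (f ∘ suc) (g ∘ suc) = interchange (f zero) (g zero) _ _
  where
  interchange : ∀ a b c d → (a + b) + (c + d) ≡ (a + c) + (b + d)
  interchange = solve-∀

ΣFin-const : ∀ n c → ΣFin {n} (λ _ → c) ≡ n * c
ΣFin-const zero    c = refl
ΣFin-const (suc n) c = cong₂ _+_ refl (ΣFin-const n c)

ΣFin-*ˡ : ∀ {n} a (f : Fin n → ℕ) → ΣFin (λ i → a * f i) ≡ a * ΣFin f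
ΣFin-*ˡ {zero}  a f = sym (ℕ.*-zeroʳ a)
ΣFin-*ˡ {suc n} a f rewrite ΣFin-*ˡ a (f ∘ suc) = sym (ℕ.*-distribˡ-+ a (f zero) _)

indicator : ∀ {A : Set} → Dec A → ℕ
indicator (yes _) = 1
indicator (no  _) = 0

indicator≤1 : ∀ {A : Set} (A? : Dec A) → indicator A? ≤ 1
indicator≤1 (yes _) = s≤s z≤n
indicator≤1 (no  _) = z≤n

Σindicator<n : ∀ {n} {P : Fin n → Set} (P? : ∀ i → Dec (P i)) → (∃ λ i → ¬ P i) →
  ΣFin (λ i → indicator (P? i)) < n
Σindicator<n {suc n} P? (zero , ¬P) with P? zero
... | yes p = contradiction p ¬P
... | no  _ = s≤s (ℕ.≤-trans (ΣFin-mono (λ i → indicator≤1 (P? (suc i))))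
                (ℕ.≤-reflexive (trans (ΣFin-const n 1) (ℕ.*-identityʳ n))))
Σindicator<n {suc n} P? (suc i , ¬P) =
  ℕ.+-mono-≤-< (indicator≤1 (P? zero)) (Σindicator<n (P? ∘ suc) (i , ¬P))

module _ {W : Set} {m : ℕ} where

  private
    -- Double counting: each word admits at most `m` of the `suc m` letters.
    Σfilter : {ok : W → Fin (suc m) → Set} (ok? : ∀ w y → Dec (ok w y)) (ws : List W) →
      (∀ {w} → w ∈ ws → ∃ λ y → ¬ ok w y) →
      ΣFin (λ y → length (filter (λ w → ok? w y) ws)) ≤ m * length ws
    Σfilter ok? [] misses = ℕ.≤-reflexive
      (trans (ΣFin-const (suc m) 0) (trans (ℕ.*-zeroʳ (suc m)) (sym (ℕ.*-zeroʳ m))))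
    Σfilter {ok} ok? (w ∷ ws) misses = begin
      ΣFin (λ y → length (filter (λ w → ok? w y) (w ∷ ws)))
        ≤⟨ ΣFin-mono split ⟩
      ΣFin (λ y → indicator (ok? w y) + length (filter (λ w → ok? w y) ws))
        ≡⟨ ΣFin-+ (λ y → indicator (ok? w y)) (λ y → length (filter (λ w → ok? w y) ws)) ⟩
      ΣFin (λ y → indicator (ok? w y)) + ΣFin (λ y → length (filter (λ w → ok? w y) ws))
        ≤⟨ ℕ.+-mono-≤ (ℕ.≤-pred (Σindicator<n (ok? w) (misses (here refl))))
             (Σfilter ok? ws (misses ∘ there)) ⟩
      m + m * length ws  ≡⟨ ℕ.*-suc m (length ws) ⟨
      m * suc (length ws) ∎
      where
      open ℕ.≤-Reasoning
      split : ∀ y → length (filter (λ w → ok? w y) (w ∷ ws)) ≤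
                    indicator (ok? w y) + length (filter (λ w → ok? w y) ws)
      split y with ok? w y
      ... | yes _ = ℕ.≤-refl
      ... | no  _ = ℕ.≤-refl

  -- Some letter has a count no larger than the average, which `Σfilter` bounds.
  rareLetter : {ok : W → Fin (suc m) → Set} (ok? : ∀ w y → Dec (ok w y)) (ws : List W) →
    (∀ {w} → w ∈ ws → ∃ λ y → ¬ ok w y) →
    ∃ λ y → suc m * length (filter (λ w → ok? w y) ws) ≤ m * length ws
  rareLetter ok? ws misses
    with Fin.any? (λ y → suc m * length (filter (λ w → ok? w y) ws) ≤? m * length ws)
  ... | yes found = found
  ... | no  none  = contradiction (begin-strict
      suc m * (m * length ws)                         ≡⟨ ΣFin-const (suc m) _ ⟨
      ΣFin {suc m} (λ _ → m * length ws)              <⟨ s≤s (ℕ.m≤n+m _ m) ⟩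
      suc m + ΣFin {suc m} (λ _ → m * length ws)
        ≡⟨ cong (_+ ΣFin {suc m} (λ _ → m * length ws)) (trans (ΣFin-const (suc m) 1) (ℕ.*-identityʳ (suc m))) ⟨
      ΣFin {suc m} (λ _ → 1) + ΣFin {suc m} (λ _ → m * length ws)
        ≡⟨ ΣFin-+ {suc m} (λ _ → 1) (λ _ → m * length ws) ⟨
      ΣFin {suc m} (λ _ → 1 + m * length ws)          ≤⟨ ΣFin-mono (λ y → ℕ.≰⇒> (λ le → none (y , le))) ⟩
      ΣFin (λ y → suc m * count y)                    ≡⟨ ΣFin-*ˡ (suc m) count ⟩
      suc m * ΣFin count                              ≤⟨ ℕ.*-monoʳ-≤ (suc m) (Σfilter ok? ws misses) ⟩
      suc m * (m * length ws)                         ∎) (ℕ.<-irrefl refl)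
    where
    open ℕ.≤-Reasoning
    count : Fin (suc m) → ℕ
    count y = length (filter (λ w → ok? w y) ws)

  -- Greedily choosing the letters of T kills a fraction 1/(m+1) of the remaining words at each step.
  uncoveredWord : ∀ d {ok : W → Fin d → Fin (suc m) → Set} (ok? : ∀ w j y → Dec (ok w j y)) (ws : List W) →
    (∀ {w} → w ∈ ws → ∀ j → ∃ λ y → ¬ ok w j y) → length ws * m ^ d < suc m ^ d →
    ∃ λ (T : Fin d → Fin (suc m)) → ∀ {w} → w ∈ ws → ∃ λ j → ¬ ok w j (T j)
  uncoveredWord zero    ok? []       misses few = (λ ()) , λ ()
  uncoveredWord zero    ok? (w ∷ ws) misses few = contradiction few λ { (s≤s ()) }
  uncoveredWord (suc d) {ok} ok? ws misses few
    with rareLetter (λ w → ok? w zero) ws (λ w∈ → misses w∈ zero)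
  ... | y , rare
    with uncoveredWord d (λ w j → ok? w (suc j)) (filter (λ w → ok? w zero y) ws)
           (λ w∈ j → misses (proj₁ (∈-filter⁻ (λ w → ok? w zero y) w∈)) (suc j)) few'
    where
    open ℕ.≤-Reasoning
    few' : length (filter (λ w → ok? w zero y) ws) * m ^ d < suc m ^ d
    few' = ℕ.*-cancelˡ-< (suc m) _ _ (begin-strict
      suc m * (length (filter (λ w → ok? w zero y) ws) * m ^ d)
        ≡⟨ ℕ.*-assoc (suc m) (length (filter (λ w → ok? w zero y) ws)) (m ^ d) ⟨
      suc m * length (filter (λ w → ok? w zero y) ws) * m ^ d    ≤⟨ ℕ.*-monoˡ-≤ (m ^ d) rare ⟩
      m * length ws * m ^ d                                     ≡⟨ shuffle m (length ws) (m ^ d) ⟩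
      length ws * m ^ suc d                                     <⟨ few ⟩
      suc m ^ suc d                                             ∎)
      where
      shuffle : ∀ a b c → a * b * c ≡ b * (a * c)
      shuffle = solve-∀
  ...   | T , hit = T' , hit'
    where
    T' : Fin (suc d) → Fin (suc m)
    T' zero    = y
    T' (suc j) = T j

    hit' : ∀ {w} → w ∈ ws → ∃ λ j → ¬ ok w j (T' j)
    hit' {w} w∈ with ok? w zero y
    ... | no ¬ok = zero , ¬ok
    ... | yes o  = let j , ¬ok = hit (∈-filter⁺ (λ w → ok? w zero y) w∈ o) in suc j , ¬ok

-- Exponential against polynomial growth

n<2^n : ∀ n → n < 2 ^ n
n<2^n zero    = s≤s z≤n
n<2^n (suc n) = begin-strict
  1 + n             <⟨ ℕ.+-mono-≤-< (ℕ.≤-trans (s≤s z≤n) (n<2^n n)) (n<2^n n) ⟩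
  2 ^ n + 2 ^ n     ≡⟨ cong₂ _+_ refl (ℕ.+-identityʳ (2 ^ n)) ⟨
  2 ^ suc n         ∎
  where open ℕ.≤-Reasoning

linear<2^ : ∀ a c → ∃ λ e → (a + e) * c < 2 ^ e
-- As `u` is at least `2 * c` and at least `a * c`, the left side is at most u + u^2, which is below
-- (u + 1)^2 and hence below 2^(2u).
linear<2^ a c = u + u , (begin-strict
  (a + (u + u)) * c                        ≡⟨ expand a c u ⟩
  a * c + u * (2 * c)                      ≤⟨ ℕ.+-mono-≤ (ℕ.m≤n+m (a * c) (2 * c))
                                                (ℕ.*-monoʳ-≤ u (ℕ.m≤m+n (2 * c) (a * c))) ⟩
  u + u * u                                <⟨ s≤s (ℕ.+-monoʳ-≤ u (ℕ.*-monoʳ-≤ u (ℕ.n≤1+n u))) ⟩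
  suc u * suc u                            ≤⟨ ℕ.*-mono-≤ (n<2^n u) (n<2^n u) ⟩
  2 ^ u * 2 ^ u                            ≡⟨ ℕ.^-distribˡ-+-* 2 u u ⟨
  2 ^ (u + u)                              ∎)
  where
  open ℕ.≤-Reasoning
  u = 2 * c + a * c
  expand : ∀ a c u → (a + (u + u)) * c ≡ a * c + u * (2 * c)
  expand = solve-∀

poly<2^ : ∀ a c → ∃ λ j → suc (j * a) ^ c < 2 ^ j
poly<2^ a c with linear<2^ a c
-- For j = 2^e the base is at most 2^(a + e), so (a + e) * c < 2^e is enough.
... | e , lt = 2 ^ e , (begin-strict
  suc (2 ^ e * a) ^ c    ≤⟨ ℕ.^-monoˡ-≤ c (ℕ.+-monoˡ-≤ (2 ^ e * a) (ℕ.≤-trans (s≤s z≤n) (n<2^n e))) ⟩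
  (2 ^ e + 2 ^ e * a) ^ c ≡⟨ cong (_^ c) (ℕ.*-suc (2 ^ e) a) ⟨
  (2 ^ e * suc a) ^ c    ≤⟨ ℕ.^-monoˡ-≤ c (ℕ.*-monoʳ-≤ (2 ^ e) (n<2^n a)) ⟩
  (2 ^ e * 2 ^ a) ^ c    ≡⟨ cong (_^ c) (ℕ.*-comm (2 ^ e) (2 ^ a)) ⟩
  (2 ^ a * 2 ^ e) ^ c    ≡⟨ cong (_^ c) (ℕ.^-distribˡ-+-* 2 a e) ⟨
  (2 ^ (a + e)) ^ c      ≡⟨ ℕ.^-*-assoc 2 (a + e) c ⟩
  2 ^ ((a + e) * c)      <⟨ ℕ.^-monoʳ-< 2 (s≤s (s≤s z≤n)) lt ⟩
  2 ^ (2 ^ e)            ∎)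
  where open ℕ.≤-Reasoning

-- Bernoulli's inequality (1 + 1/m)^n ≥ 1 + n/m, cleared of denominators.
bernoulli : ∀ m n → m ^ n * (m + n) ≤ suc m ^ n * m
bernoulli m zero    = ℕ.≤-reflexive (cong (1 *_) (ℕ.+-identityʳ m))
bernoulli m (suc n) = begin
  m * m ^ n * (m + suc n)              ≤⟨ ℕ.m≤m+n _ (n * m ^ n) ⟩
  m * m ^ n * (m + suc n) + n * m ^ n  ≡⟨ factor m n (m ^ n) ⟩
  suc m * (m ^ n * (m + n))            ≤⟨ ℕ.*-monoʳ-≤ (suc m) (bernoulli m n) ⟩
  suc m * (suc m ^ n * m)              ≡⟨ ℕ.*-assoc (suc m) (suc m ^ n) m ⟨
  suc m * suc m ^ n * m                ∎
  where
  open ℕ.≤-Reasoning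
  factor : ∀ m n p → m * p * (m + suc n) + n * p ≡ suc m * (p * (m + n))
  factor = solve-∀

double : ∀ m .{{_ : NonZero m}} → 2 * m ^ m ≤ suc m ^ m
double m = ℕ.*-cancelʳ-≤ _ _ m (begin
  2 * m ^ m * m      ≡⟨ regroup m (m ^ m) ⟩
  m ^ m * (m + m)    ≤⟨ bernoulli m m ⟩
  suc m ^ m * m      ∎)
  where
  open ℕ.≤-Reasoning
  regroup : ∀ m p → 2 * p * m ≡ p * (m + m)
  regroup = solve-∀

^-distribʳ-* : ∀ n a b → (a * b) ^ n ≡ a ^ n * b ^ n
^-distribʳ-* zero    a b = refl
^-distribʳ-* (suc n) a b rewrite ^-distribʳ-* n a b = interchange a b (a ^ n) (b ^ n)
  where
  interchange : ∀ a b c d → a * b * (c * d) ≡ a * c * (b * d)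
  interchange = solve-∀

-- Taking d = m j, the ratio (m+1)^d / m^d is at least 2^j.
manyWords : ∀ m .{{_ : NonZero m}} b c → ∃ λ d → suc (d * b) ^ c * m ^ d < suc m ^ d
manyWords m b c with poly<2^ (m * b) c
... | j , lt = m * j , (begin-strict
  suc (m * j * b) ^ c * m ^ (m * j)    ≡⟨ cong (λ n → suc n ^ c * m ^ (m * j)) (regroup m j b) ⟩
  suc (j * (m * b)) ^ c * m ^ (m * j)  <⟨ ℕ.*-monoˡ-< (m ^ (m * j)) {{ℕ.m^n≢0 m (m * j)}} lt ⟩
  2 ^ j * m ^ (m * j)                  ≡⟨ cong (2 ^ j *_) (ℕ.^-*-assoc m m j) ⟨
  2 ^ j * (m ^ m) ^ j                  ≡⟨ ^-distribʳ-* j 2 (m ^ m) ⟨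
  (2 * m ^ m) ^ j                      ≤⟨ ℕ.^-monoˡ-≤ j (double m) ⟩
  (suc m ^ m) ^ j                      ≡⟨ ℕ.^-*-assoc (suc m) m j ⟩
  suc m ^ (m * j)                      ∎)
  where
  open ℕ.≤-Reasoning
  regroup : ∀ m j b → m * j * b ≡ j * (m * b)
  regroup = solve-∀

-- The choice of the core M

module _ {h : ℕ} (H : Graph h) {s : ℕ} where

  -- Partial colourings are vectors, with `nothing` at uncoloured vertices, so that they can be
  -- enumerated.
  Proper : Vec (Maybe (Fin s)) h → Set
  Proper c = ∀ u v j → lookup c u ≡ just j → lookup c v ≡ just j → ¬ Adj H u v

  Core : Vec (Maybe (Fin s)) h → Rel (Fin h) 0ℓ
  Core c u v = Adj H u v × lookup c u ≡ nothing × lookup c v ≡ nothing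

  Core-sym : ∀ c → Symmetric (Core c)
  Core-sym c (e , cu , cv) = symm H e , cv , cu

  Core? : ∀ c → Decidable (Core c)
  Core? c u v = adj? H u v ×-dec (isNothing? u ×-dec isNothing? v)
    where
    isNothing? : ∀ u → Dec (lookup c u ≡ nothing)
    isNothing? u = Maybe.≡-dec Fin._≟_ (lookup c u) nothing

  extendColouring : ∀ c → Proper c → (κ : Fin h → Bool) → (∀ {u v} → Core c u v → κ u ≢ κ v) →
    Colourable H (2 + s)
  extendColouring c proper κ κ-proper = (λ u → colour (lookup c u) (κ u)) , λ {u} {v} → valid u v
    where
    colour : Maybe (Fin s) → Bool → Fin (2 + s)
    colour (just j) _     = suc (suc j)
    colour nothing  true  = suc zero
    colour nothing  false = zero

    colour-nothing : ∀ b b' → colour nothing b ≡ colour nothing b' → b ≡ b'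
    colour-nothing true  true  _ = refl
    colour-nothing false false _ = refl

    valid : ∀ u v → Adj H u v → colour (lookup c u) (κ u) ≢ colour (lookup c v) (κ v)
    valid u v e eq with lookup c u in cu | lookup c v in cv
    ... | just i  | just j  with refl ← Fin.suc-injective (Fin.suc-injective eq) = proper u v i cu cv e
    ... | nothing | nothing = κ-proper (e , cu , cv) (colour-nothing (κ u) (κ v) eq)
    ... | just i  | nothing with κ v
    ...   | true  = contradiction eq λ ()
    ...   | false = contradiction eq λ ()
    valid u v e eq | nothing | just j with κ u
    ...   | true  = contradiction eq λ ()
    ...   | false = contradiction eq λ ()

  -- A core without odd closed walks is bipartite, and two further colours would then colour `H`. So
  -- each core of a proper `c` has one, and there are only finitely many cores.
  boundedOddGirth : ¬ Colourable H (2 + s) →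
    ¬ ¬ ∃ λ g → ∀ c → Proper c → ¬ NoOdd (Core c) g
  boundedOddGirth ¬col = ¬¬-bound-Vec enum onto (λ c g → Proper c → ¬ NoOdd (Core c) g)
    (λ c g≤g' p proper noOdd → p proper (NoOdd-antitone g≤g' noOdd)) eachBounded
    where
    enum : Fin (suc s) → Maybe (Fin s)
    enum zero    = nothing
    enum (suc j) = just j

    onto : ∀ y → ∃ λ i → enum i ≡ y
    onto nothing  = zero , refl
    onto (just j) = suc j , refl

    eachBounded : ∀ c → ¬ ¬ ∃ λ g → Proper c → ¬ NoOdd (Core c) g
    eachBounded c = do
      yes proper ← ¬¬-excluded-middle {A = Proper c}
        where no ¬proper → return (0 , λ proper → contradiction proper ¬proper)
      λ unbounded →
        bipartite (Core c) (Core-sym c)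
          (λ g u n n≤g odd-n w → unbounded (g , λ _ noOdd → noOdd u n n≤g odd-n w))
          λ { (κ , κ-proper) → ¬col (extendColouring c proper κ κ-proper) }

  -- The largest odd girth of a core is suc g.
  record Configuration : Set where
    field
      c       : Vec (Maybe (Fin s)) h
      proper  : Proper c
      x       : Fin h
      L       : List (Fin h)
      g       : ℕ
      girth   : NoOdd (Core c) g
      killed  : NoOdd (Del (Core c) (x ∷ L)) (suc g)
      minimal : ∀ c' → Proper c' → NoOdd (Core c') g →
                ∀ L' → length L' ≡ length L → ¬ NoOdd (Del (Core c') L') (suc g)

  configuration : ¬ Colourable H (2 + s) → ¬ ¬ Configuration
  configuration ¬col = do
    g₀ , bound ← boundedOddGirth ¬col
    -- `suc g` is the least length up to which every core has an odd closed walk; hence some core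
    -- has none of length at most `g`.
    suc g , bad , good ← ¬¬-least (λ g → ∀ c → Proper c → ¬ NoOdd (Core c) g) g₀ bound
      where (zero , bad , _) → contradiction (λ { u .0 z≤n () }) (bad allNothing λ u v j eq →
              contradiction (trans (sym eq) (Vec.lookup-replicate u nothing)) λ ())
    c₀ , proper₀ , girth₀ ← λ k → good g ℕ.≤-refl λ c proper noOdd → k (c , proper , noOdd)
    -- A smallest killing set is nonempty, because no core is without odd closed walks up to length
    -- `suc g`; this provides `x`.
    (suc t , (c , x ∷ L , proper , girth , killed , len) , least) ←
      ¬¬-least (Killing g) (length (allFin h)) (c₀ , allFin h , proper₀ , girth₀ , kill-all {c₀} , refl)
      where (zero , (c , [] , proper , _ , killed , _) , _) →
              contradiction (λ u n n≤g odd-n w → killed u n n≤g odd-n (mapʷ id (λ e → e , (λ ()) , λ ()) w))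
                            (bad c proper)
    return record
      { c = c ; proper = proper ; x = x ; L = L ; g = g ; girth = girth ; killed = killed
      ; minimal = λ c' proper' girth' L' len' killed' → least t ℕ.≤-refl
          (c' , L' , proper' , girth' , killed' , trans len' (ℕ.suc-injective len)) }
    where
    allNothing : Vec (Maybe (Fin s)) h
    allNothing = replicate h nothing

    Killing : ℕ → ℕ → Set
    Killing g t = ∃ λ c → ∃ λ L →
      Proper c × NoOdd (Core c) g × NoOdd (Del (Core c) L) (suc g) × length L ≡ t

    kill-all : ∀ {c g} → NoOdd (Del (Core c) (allFin h)) g
    kill-all _ _ n≤g () []
    kill-all _ _ n≤g odd-n ((_ , u∉ , _) ∷ _) = u∉ (∈-allFin _)

-- Parity identities

not-xorˡ : ∀ a b → not (a xor b) ≡ not a xor b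
not-xorˡ true  b = Bool.not-involutive b
not-xorˡ false b = refl

not-xorᵐ : ∀ a b c → not (a xor (b xor c)) ≡ a xor (not b xor c)
not-xorᵐ a true  c = trans (not-xorʳ a (not c)) (cong (a xor_) (Bool.not-involutive c))
  where
  not-xorʳ : ∀ a b → not (a xor b) ≡ a xor not b
  not-xorʳ true  b = refl
  not-xorʳ false b = refl
not-xorᵐ true  false c = refl
not-xorᵐ false false c = refl

not-xor-true : ∀ a → not a ≡ a xor true
not-xor-true true  = refl
not-xor-true false = refl

not-xor-self : ∀ a → not a xor a ≡ true
not-xor-self true  = refl
not-xor-self false = refl

xor-selfʳ : ∀ a b → a xor (b xor b) ≡ a
xor-selfʳ true  true  = refl
xor-selfʳ true  false = refl
xor-selfʳ false true  = refl
xor-selfʳ false false = refl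

-- The graph G₀

∈-N : ∀ {n} (G : Graph n) {u v} → Adj G u v → v Sub.∈ N G u
∈-N G {u} {v} e = Vec.lookup⇒[]= v _ (trans (Vec.lookup∘tabulate _ v) (dec-true (adj? G u v) e))

∈-N⁻ : ∀ {n} (G : Graph n) {u v} → v Sub.∈ N G u → Adj G u v
∈-N⁻ G {u} {v} v∈ with adj? G u v | trans (sym (Vec.lookup∘tabulate (does ∘ adj? G u) v)) (Vec.[]=⇒lookup v∈)
... | yes e | _ = e

degree-injection : ∀ {n m} (G : Graph n) v (f : Fin m → Fin n) → Injective _≡_ _≡_ f →
  (∀ i → Adj G v (f i)) → m ≤ degree G v
degree-injection G v f inj adj = ∣p∣-injection (N G v) f inj (∈-N G ∘ adj)

minDegree : ∀ {n m} (G : Graph n) → m ≤ n → (∀ v → m ≤ degree G v) → m ≤ δ G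
minDegree {n} G m≤n m≤deg = v≤min⁺ m≤n (All.map⁺ (All.tabulate {xs = allFin n} λ {v} _ → m≤deg v))

-- `S` is itself cut out by a trace on `A`, so it lies in `A`, and restricting neighbourhoods to `A`
-- first makes no difference on `S`.
shatters⇒shattered : ∀ {n} (G : Graph n) (A S : Subset n) →
  Shatters (λ w → ∃ λ v → N G v ∩ A ≡ w) S → Shattered G S
shatters⇒shattered G A S sh T T⊆S with sh T T⊆S
... | _ , (v , refl) , eq = v , (begin
  N G v ∩ S         ≡⟨ cong (N G v ∩_) (Subₚ.⊆-antisym (Subₚ.p∩q⊆q A S) (λ y∈ → Subₚ.x∈p∩q⁺ (S⊆A y∈ , y∈))) ⟨
  N G v ∩ (A ∩ S)   ≡⟨ Subₚ.∩-assoc (N G v) A S ⟨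
  (N G v ∩ A) ∩ S   ≡⟨ eq ⟩
  T                 ∎)
  where
  open ≡-Reasoning
  S⊆A : S ⊆ A
  S⊆A y∈ with sh S Subₚ.⊆-refl
  ... | _ , (v , refl) , eq = proj₂ (Subₚ.x∈p∩q⁻ _ _ (proj₁ (Subₚ.x∈p∩q⁻ _ _ (subst (_ Sub.∈_) (sym eq) y∈))))

module Construction {k s : ℕ} (H : Graph (suc k)) (C : Configuration H {s}) (d t : ℕ)
  (u₀ : Fin (suc k)) (u₀-edge : ∃ λ v → Core H (Configuration.c C) u₀ v) where

  open Configuration C

  -- The choice `b = k * t` balances the degrees: a vertex of a large class loses the `k * t`
  -- vertices of its class but sees all `suc k` clusters of size `t`, while any other vertex sees
  -- all large classes and at least one cluster. Either way this gives `s * b + t`.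
  h b : ℕ
  h = suc k
  b = k * t

  open DecMembership (Fin._≟_ {h}) using (_∈?_)

  M : Rel (Fin h) 0ℓ
  M = Core H c

  M-sym : Symmetric M
  M-sym = Core-sym H c

  M-irrefl : ∀ {u} → ¬ M u u
  M-irrefl (e , _) = irrefl H refl e

  M? : Decidable M
  M? = Core? H c

  -- Joining clusters only across `κ` makes the graph on them bipartite, yet leaves each cluster a
  -- neighbouring one, as the minimum degree requires.
  κ : Fin h → Bool
  κ = proj₁ (dominatingBipartition M M? M-sym M-irrefl)

  κ-neighbour : ∀ {u v} → M u v → ∃ λ w → M u w × κ u ≢ κ w
  κ-neighbour = proj₂ (dominatingBipartition M M? M-sym M-irrefl)

  -- Vertices that are isolated in M borrow the cluster of u₀.
  π : Fin h → Fin h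
  π z with Fin.any? (M? z)
  ... | yes _ = z
  ... | no  _ = u₀

  π-neighbour : ∀ z → ∃ λ v → M (π z) v
  π-neighbour z with Fin.any? (M? z)
  ... | yes e = e
  ... | no  _ = u₀-edge

  π-fix : ∀ {z v} → M z v → π z ≡ z
  π-fix {z} e with Fin.any? (M? z)
  ... | yes _ = refl
  ... | no ¬e = contradiction (_ , e) ¬e

  -- F consists of the vertices s T (with T coded in Fin (h ^ d)), q j z and w z; the summand
  -- Fin h × Fin t holds the clusters and Fin s × Fin b the large independent classes.
  F : Set
  F = Fin (h ^ d) ⊎ (Fin d × Fin h ⊎ Fin h)

  U : Set
  U = F ⊎ Fin h × Fin t

  V : Set
  V = U ⊎ Fin s × Fin b

  pattern sᵛ T   = inj₁ T
  pattern qᵛ j z = inj₂ (inj₁ (j , z))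
  pattern wᵛ z   = inj₂ (inj₂ z)

  class : F → Fin h
  class (sᵛ T)   = x
  class (qᵛ j z) = z
  class (wᵛ z)   = z

  -- Keeps `F` a plain sum: the unwanted `q j z` with `z` in `x ∷ L` and `w z` with `z` outside `L`
  -- exist, but have no edges inside `F`.
  Active : F → Set
  Active (sᵛ T)   = ⊤
  Active (qᵛ j z) = z ∉ x ∷ L
  Active (wᵛ z)   = z ∈ L

  Compatible : F → F → Set
  Compatible (sᵛ T)   (qᵛ j z)  = z ≡ finToFun T j
  Compatible (qᵛ j z) (sᵛ T)    = z ≡ finToFun T j
  Compatible (qᵛ j _) (qᵛ j' _) = j ≡ j'
  Compatible _        _         = ⊤

  EF : Rel F 0ℓ
  EF a b = M (class a) (class b) × Active a × Active b × Compatible a b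

  EU : Rel U 0ℓ
  EU (inj₁ a)        (inj₁ b)         = EF a b
  EU (inj₁ a)        (inj₂ (z , _))   = π (class a) ≡ π z
  EU (inj₂ (z , _))  (inj₁ a)         = π (class a) ≡ π z
  EU (inj₂ (z , _))  (inj₂ (z' , _))  = M (π z) (π z') × κ (π z) ≢ κ (π z')

  E : Rel V 0ℓ
  E (inj₁ a)        (inj₁ b)         = EU a b
  E (inj₁ _)        (inj₂ _)         = ⊤
  E (inj₂ _)        (inj₁ _)         = ⊤
  E (inj₂ (j , _))  (inj₂ (j' , _))  = j ≢ j'

  active? : ∀ a → Dec (Active a)
  active? (sᵛ T)   = yes tt
  active? (qᵛ j z) = ¬? (z ∈? (x ∷ L))
  active? (wᵛ z)   = z ∈? L

  compatible? : Decidable Compatible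
  compatible? (sᵛ T)   (sᵛ T')   = yes tt
  compatible? (sᵛ T)   (qᵛ j z)  = z Fin.≟ finToFun T j
  compatible? (sᵛ T)   (wᵛ z)    = yes tt
  compatible? (qᵛ j z) (sᵛ T)    = z Fin.≟ finToFun T j
  compatible? (qᵛ j _) (qᵛ j' _) = j Fin.≟ j'
  compatible? (qᵛ j _) (wᵛ _)    = yes tt
  compatible? (wᵛ _)   (sᵛ _)    = yes tt
  compatible? (wᵛ _)   (qᵛ _ _)  = yes tt
  compatible? (wᵛ _)   (wᵛ _)    = yes tt

  compatible-sym : Symmetric Compatible
  compatible-sym {sᵛ _}   {sᵛ _}   p = tt
  compatible-sym {sᵛ _}   {qᵛ _ _} p = p
  compatible-sym {sᵛ _}   {wᵛ _}   p = tt
  compatible-sym {qᵛ _ _} {sᵛ _}   p = p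
  compatible-sym {qᵛ _ _} {qᵛ _ _} p = sym p
  compatible-sym {qᵛ _ _} {wᵛ _}   p = tt
  compatible-sym {wᵛ _}   {sᵛ _}   p = tt
  compatible-sym {wᵛ _}   {qᵛ _ _} p = tt
  compatible-sym {wᵛ _}   {wᵛ _}   p = tt

  E? : Decidable E
  E? (inj₁ (inj₁ a)) (inj₁ (inj₁ b)) =
    M? (class a) (class b) ×-dec (active? a ×-dec (active? b ×-dec compatible? a b))
  E? (inj₁ (inj₁ a)) (inj₁ (inj₂ (z , _))) = π (class a) Fin.≟ π z
  E? (inj₁ (inj₂ (z , _))) (inj₁ (inj₁ a)) = π (class a) Fin.≟ π z
  E? (inj₁ (inj₂ (z , _))) (inj₁ (inj₂ (z' , _))) =
    M? (π z) (π z') ×-dec ¬? (κ (π z) Bool.≟ κ (π z'))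
  E? (inj₁ _)       (inj₂ _)        = yes tt
  E? (inj₂ _)       (inj₁ _)        = yes tt
  E? (inj₂ (j , _)) (inj₂ (j' , _)) = ¬? (j Fin.≟ j')

  E-sym : Symmetric E
  E-sym {inj₁ (inj₁ a)} {inj₁ (inj₁ b)} (m , p , q , r) = M-sym m , q , p , compatible-sym {a} {b} r
  E-sym {inj₁ (inj₁ a)} {inj₁ (inj₂ _)} p       = p
  E-sym {inj₁ (inj₂ _)} {inj₁ (inj₁ a)} p       = p
  E-sym {inj₁ (inj₂ _)} {inj₁ (inj₂ _)} (m , p) = M-sym m , p ∘ sym
  E-sym {inj₁ _}        {inj₂ _}        _       = tt
  E-sym {inj₂ _}        {inj₁ _}        _       = tt
  E-sym {inj₂ _}        {inj₂ _}        p       = p ∘ sym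

  E-irrefl : ∀ {v} → ¬ E v v
  E-irrefl {inj₁ (inj₁ a)} (m , _) = M-irrefl m
  E-irrefl {inj₁ (inj₂ _)} (m , _) = M-irrefl m
  E-irrefl {inj₂ _}        p       = p refl

  -- The odd girth of `G₀` outside the large classes

  Φ : U → Fin h
  Φ (inj₁ a)       = π (class a)
  Φ (inj₂ (z , _)) = π z

  side : U → Bool
  side (inj₁ _) = false
  side (inj₂ _) = true

  -- `π` fixes both ends of an edge of `M`, so edges inside `F` survive `Φ`; those between `F` and
  -- the clusters collapse.
  project : ∀ {u v} → EU u v →
    (M (Φ u) (Φ v) × side u ≡ side v) ⊎ (Φ u ≡ Φ v × side u ≡ not (side v))
  project {inj₁ a} {inj₁ b} (m , _) =
    inj₁ (subst₂ M (sym (π-fix m)) (sym (π-fix (M-sym m))) m , refl)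
  project {inj₁ a} {inj₂ _} p       = inj₂ (p , refl)
  project {inj₂ _} {inj₁ a} p       = inj₂ (sym p , refl)
  project {inj₂ _} {inj₂ _} (m , _) = inj₁ (m , refl)

  Straight : Rel U 0ℓ → Rel U 0ℓ
  Straight R u v = R u v × side u ≡ side v

  straight-M : ∀ {u v} → Straight EU u v → M (Φ u) (Φ v)
  straight-M {u} {v} (e , eq) with project {u} {v} e
  ... | inj₁ (m , _)   = m
  ... | inj₂ (_ , neq) = contradiction (trans (sym neq) eq) (Bool.not-¬ refl ∘ sym)

  straight-side : ∀ {R u v n} → Walk (Straight R) u v n → side u ≡ side v
  straight-side []             = refl
  straight-side ((_ , eq) ∷ p) = trans eq (straight-side p)

  -- A crossing between the two sides of the walk is contracted by Φ, so only straight walks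
  -- keep their length.
  contract : ∀ {R} → (∀ {u v} → R u v → EU u v) → ∀ {u v n} → Walk R u v n →
    Walk (Straight R) u v n ⊎
    (∃ λ m → m < n × Walk M (Φ u) (Φ v) m × odd n ≡ odd m xor (side u xor side v))
  contract R⊆EU [] = inj₁ []
  contract {R} R⊆EU {u} {v} {suc n} (_∷_ {v = u'} e p)
    with project {u} {u'} (R⊆EU e) | contract R⊆EU p
  ... | inj₁ (m , eq) | inj₁ q = inj₁ ((e , eq) ∷ q)
  ... | inj₁ (m , eq) | inj₂ (l , l<n , q , par) = inj₂ (suc l , s≤s l<n , m ∷ q ,
        trans (cong not par) (trans (not-xorˡ (odd l) _) (cong (λ b → not (odd l) xor (b xor side v)) (sym eq))))
  ... | inj₂ (eq , neq) | inj₁ q = inj₂ (n , ℕ.≤-refl ,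
        subst (λ z → Walk M z (Φ v) n) (sym eq)
          (mapʷ Φ (λ {u} {v} (e , eq) → straight-M {u} {v} (R⊆EU e , eq)) q) ,
        trans (not-xor-true (odd n)) (cong (odd n xor_) (sym (trans
          (cong₂ _xor_ neq (sym (straight-side q))) (not-xor-self (side u'))))))
  ... | inj₂ (eq , neq) | inj₂ (l , l<n , q , par) = inj₂ (l , ℕ.m≤n⇒m≤1+n l<n ,
        subst (λ z → Walk M z (Φ v) l) (sym eq) q ,
        trans (cong not par) (trans (not-xorᵐ (odd l) (side u') (side v))
          (cong (λ b → odd l xor (b xor side v)) (sym neq))))

  -- A closed walk changes sides an even number of times, so its contraction to `M` has the same
  -- parity and is no longer.
  noOdd-EU : NoOdd EU g
  noOdd-EU u n n≤g odd-n p with contract id p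
  ... | inj₁ q = girth _ n n≤g odd-n (mapʷ Φ (λ {a} {b} → straight-M {a} {b}) q)
  ... | inj₂ (m , m<n , q , par) = girth _ m (ℕ.≤-trans (ℕ.<⇒≤ m<n) n≤g)
          (trans (sym (xor-selfʳ (odd m) (side u))) (trans (sym par) odd-n)) q

  hubs : List U
  hubs = map (λ z → inj₁ (wᵛ z)) L

  E⁻ : Rel U 0ℓ
  E⁻ = Straight (Del EU hubs)

  E⁻-M : ∀ {u v} → E⁻ u v → M (Φ u) (Φ v)
  E⁻-M {u} {v} ((e , _) , eq) = straight-M {u} {v} (e , eq)

  -- A straight walk that starts in a cluster stays in the clusters, and each of its edges changes
  -- `κ`.
  bipartite-X : ∀ {u v n} → side u ≡ true → Walk E⁻ u v n → odd n ≡ κ (Φ u) xor κ (Φ v)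
  bipartite-X {u} X [] = sym (xor-selfʳ false (κ (Φ u)))
  bipartite-X {inj₂ _} {v} X (_∷_ {v = inj₂ (z , _)} (((_ , κ≢) , _) , _) p) =
    trans (cong not (bipartite-X refl p)) (trans (not-xorˡ (κ (π z)) _)
      (cong (_xor κ (Φ v)) (sym (Bool.¬-not κ≢))))
  bipartite-X {inj₂ _} X (_∷_ {v = inj₁ _} (_ , ()) p)

  K : Rel (Fin h) 0ℓ
  K = Del M (x ∷ L)

  -- With the hubs deleted, a straight walk can leave the j-th copy only through some `s T`, and
  -- then from the one vertex `T j` that `s T` sees there.
  firstReturn : ∀ {j z v n} → Walk E⁻ (inj₁ (qᵛ j z)) v n →
    (∃ λ z' → v ≡ inj₁ (qᵛ j z') × Walk K z z' n) ⊎
    (∃ λ T → ∃ λ m → ∃ λ l → n ≡ m + suc l × Walk K z (finToFun T j) m × M (finToFun T j) x ×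
      Walk E⁻ (inj₁ (qᵛ j z)) (inj₁ (sᵛ T)) (suc m) × Walk E⁻ (inj₁ (sᵛ T)) v l)
  firstReturn [] = inj₁ (_ , refl , [])
  firstReturn (_∷_ {v = inj₁ (sᵛ T)} e@(((m , _ , _ , refl) , _) , _) p) =
    inj₂ (T , 0 , _ , refl , [] , m , e ∷ [] , p)
  firstReturn (_∷_ {v = inj₁ (qᵛ j z)} e@(((m , az , az' , refl) , _) , _) p) with firstReturn p
  ... | inj₁ (z' , eq , k) = inj₁ (z' , eq , (m , az , az') ∷ k)
  ... | inj₂ (T , n , l , eq , k , mx , q , r) =
        inj₂ (T , suc n , l , cong suc eq , (m , az , az') ∷ k , mx , e ∷ q , r)
  firstReturn (_∷_ {v = inj₁ (wᵛ z)} (((_ , _ , z∈L , _) , _ , z∉) , _) p) =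
    contradiction (∈-map⁺ _ z∈L) z∉
  firstReturn (_∷_ {v = inj₂ _} (_ , ()) p)

  -- Every `s T` lies over `x`, so the first later visit to some `s T'` cuts the walk into two parts
  -- closed in `M`, one of them odd. If both are nonempty, the odd one is too short for `girth`. If
  -- the second is empty, the walk enters and leaves one copy at the same vertex `T j`; without its
  -- first and last edge it is an odd closed walk avoiding `x ∷ L`, against `killed`.
  noOdd-s : ∀ T n → n ≤ suc g → odd n ≡ true → ¬ Walk E⁻ (inj₁ (sᵛ T)) (inj₁ (sᵛ T)) n
  noOdd-s T _ n≤g () []
  noOdd-s T _ n≤g odd-n (_∷_ {v = inj₁ (sᵛ T')} (((m , _) , _) , _) p) = M-irrefl m
  noOdd-s T _ n≤g odd-n (_∷_ {v = inj₁ (wᵛ z)} (((_ , _ , z∈L , _) , _ , z∉) , _) p) =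
    z∉ (∈-map⁺ _ z∈L)
  noOdd-s T _ n≤g odd-n (_∷_ {v = inj₂ _} (_ , ()) p)
  noOdd-s T (suc n) (s≤s n≤g) odd-n (_∷_ {v = inj₁ (qᵛ j z)} (((mz , _ , _ , z≡) , _) , _) p)
    with firstReturn p
  ... | inj₁ (_ , () , _)
  ... | inj₂ (T' , m , l , refl , k , mx , _ , q) with odd l in odd-l
  ...   | true = girth _ l (ℕ.≤-trans (ℕ.≤-trans (ℕ.n≤1+n l) (ℕ.m≤n+m (suc l) m)) n≤g) odd-l
                   (mapʷ Φ (λ {a} {b} → E⁻-M {a} {b}) q)
  ...   | false with q
  ...     | [] = killed _ m (ℕ.≤-trans (ℕ.m≤m+n m 1) (ℕ.m≤n⇒m≤1+n n≤g)) odd-m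
                   (subst (λ y → Walk K y (finToFun T j) m) z≡ k)
    where
    odd-m : odd m ≡ true
    odd-m = trans (sym (Bool.not-involutive (odd m)))
              (trans (cong not (cong odd (ℕ.+-comm 1 m))) odd-n)
  ...     | _∷_ {n = l'} _ _ = girth x (suc (m + 1))
            (ℕ.≤-trans (ℕ.≤-reflexive (sym (ℕ.+-suc m 1)))
              (ℕ.≤-trans (ℕ.+-monoʳ-≤ m (s≤s (s≤s z≤n))) n≤g)) odd-m
            (mz ∷ (mapʷ id proj₁ k ++ʷ (mx ∷ [])))
    where
    odd-m : odd (suc (m + 1)) ≡ true
    odd-m = trans (cong not (trans (odd-+ m 1)
      (sym (trans (odd-+ m (suc (suc l'))) (cong (λ b → odd m xor not b) odd-l))))) odd-n

  -- A walk with a crossing gets strictly shorter in `M`, so `girth` applies even at length `suc g`.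
  -- A straight one runs in the bipartite clusters, stays in one copy, or can be rotated to start at
  -- some `s T`.
  noOdd-EU⁻ : NoOdd (Del EU hubs) (suc g)
  noOdd-EU⁻ u n n≤g odd-n p with contract proj₁ p
  ... | inj₂ (m , m<n , q , par) = girth _ m (ℕ.≤-pred (ℕ.≤-trans m<n n≤g))
          (trans (sym (xor-selfʳ (odd m) (side u))) (trans (sym par) odd-n)) q
  ... | inj₁ q = straight u q
    where
    straight : ∀ u → ¬ Walk E⁻ u u n
    straight (inj₂ (z , i)) q =
      contradiction (trans (sym odd-n) (trans (bipartite-X refl q) (xor-selfʳ false (κ (π z))))) λ ()
    straight (inj₁ (sᵛ T)) q = noOdd-s T n n≤g odd-n q
    straight (inj₁ (qᵛ j z)) q with firstReturn q
    ... | inj₁ (_ , refl , k) = killed z n n≤g odd-n k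
    ... | inj₂ (T , m , l , refl , _ , _ , p , r) =
          noOdd-s T (l + suc m) (subst (_≤ suc g) eq n≤g) (trans (cong odd (sym eq)) odd-n) (r ++ʷ p)
      where
      eq : m + suc l ≡ l + suc m
      eq = trans (ℕ.+-suc m l) (trans (cong suc (ℕ.+-comm m l)) (sym (ℕ.+-suc l m)))
    straight (inj₁ (wᵛ z)) [] = contradiction odd-n λ ()
    straight (inj₁ (wᵛ z)) (_∷_ {v = inj₁ _} (((_ , z∈L , _) , z∉ , _) , _) p) = z∉ (∈-map⁺ _ z∈L)
    straight (inj₁ (wᵛ z)) (_∷_ {v = inj₂ _} (_ , ()) p)

  -- Numbering of the vertices

  n : ℕ
  n = ((h ^ d + (d * h + h)) + h * t) + s * b

  vertices : Fin n ↔ V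
  vertices = ↔-trans Fin.+↔⊎ (↔-trans Fin.+↔⊎
    (↔-trans Fin.+↔⊎ (↔-refl ⊎-↔ ↔-trans Fin.+↔⊎ (Fin.*↔× ⊎-↔ ↔-refl)) ⊎-↔ Fin.*↔×) ⊎-↔ Fin.*↔×)

  dec : Fin n → V
  dec = Inverse.to vertices

  enc : V → Fin n
  enc = Inverse.from vertices

  dec-enc : ∀ v → dec (enc v) ≡ v
  dec-enc = Inverse.strictlyInverseˡ vertices

  enc-dec : ∀ i → enc (dec i) ≡ i
  enc-dec = Inverse.strictlyInverseʳ vertices

  enc-injective : Injective _≡_ _≡_ enc
  enc-injective = Injection.injective (↔⇒↣ (↔-sym vertices))

  G₀ : Graph n
  G₀ = record
    { Adj    = λ i j → E (dec i) (dec j)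
    ; adj?   = λ i j → E? (dec i) (dec j)
    ; symm   = λ {i} {j} → E-sym {dec i} {dec j}
    ; irrefl = λ { {i} refl → E-irrefl {dec i} }
    }

  E⇒Adj : ∀ {u v} → E u v → Adj G₀ (enc u) (enc v)
  E⇒Adj {u} {v} = subst₂ E (sym (dec-enc u)) (sym (dec-enc v))

  -- `G₀` is `H`-free

  private
    label : V → Maybe (Fin s)
    label (inj₁ _)       = nothing
    label (inj₂ (j , _)) = just j

    strip : V → U
    strip (inj₁ a) = a
    -- An arbitrary value: `strip` matters only where the label is `nothing`.
    strip (inj₂ _) = inj₁ (wᵛ u₀)

    label-nothing : ∀ v → label v ≡ nothing → v ≡ inj₁ (strip v)
    label-nothing (inj₁ _) _ = refl

    label-just : ∀ u v j → label u ≡ just j → label v ≡ just j → ¬ E u v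
    label-just (inj₂ _) (inj₂ _) j refl refl j≢j = j≢j refl

  -- The large classes induce a proper partial colouring of a copy of `H`. Its core maps to the rest
  -- of `G₀`, so it has no odd closed walk up to length `g`, and deleting the preimages of the hubs
  -- excludes length `suc g` too. These are one fewer than `x ∷ L`, against minimality.
  free : Free H G₀
  free (f , f-inj , f-hom) = minimal c' proper' girth' L' (length-map pre L) killed'
    where
    φ : Fin h → V
    φ = dec ∘ f

    ψ : Fin h → U
    ψ = strip ∘ φ

    c' : Vec (Maybe (Fin s)) h
    c' = tabulate (label ∘ φ)

    c'≡ : ∀ {u y} → lookup c' u ≡ y → label (φ u) ≡ y
    c'≡ {u} eq = trans (sym (Vec.lookup∘tabulate (label ∘ φ) u)) eq

    proper' : Proper H c'
    proper' u v j cu cv e = label-just (φ u) (φ v) j (c'≡ cu) (c'≡ cv) (f-hom e)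

    φ≡ψ : ∀ {u} → lookup c' u ≡ nothing → φ u ≡ inj₁ (ψ u)
    φ≡ψ {u} cu = label-nothing (φ u) (c'≡ cu)

    ψ-hom : ∀ {u v} → Core H c' u v → EU (ψ u) (ψ v)
    ψ-hom (e , cu , cv) = subst₂ E (φ≡ψ cu) (φ≡ψ cv) (f-hom e)

    girth' : NoOdd (Core H c') g
    girth' u n n≤g odd-n p = noOdd-EU (ψ u) n n≤g odd-n (mapʷ ψ ψ-hom p)

    hub : Fin h → Fin n
    hub z = enc (inj₁ (inj₁ (wᵛ z)))

    pre : Fin h → Fin h
    pre z with Fin.any? (λ u → f u Fin.≟ hub z)
    ... | yes (u , _) = u
    -- A hub missed by the copy gets an arbitrary preimage, so that `L'` has exactly the length of
    -- `L`, as `minimal` demands.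
    ... | no  _       = z

    pre-unique : ∀ {u z} → f u ≡ hub z → u ≡ pre z
    pre-unique {u} {z} eq with Fin.any? (λ u → f u Fin.≟ hub z)
    ... | yes (u' , eq') = f-inj (trans eq (sym eq'))
    ... | no none        = contradiction (u , eq) none

    L' : List (Fin h)
    L' = map pre L

    avoids : ∀ {u} → lookup c' u ≡ nothing → u ∉ L' → ψ u ∉ hubs
    avoids {u} cu u∉ ψu∈ with ∈-map⁻ _ ψu∈
    ... | z , z∈L , eq = u∉ (subst (_∈ L') (sym (pre-unique
            (trans (sym (enc-dec (f u))) (cong enc (trans (φ≡ψ cu) (cong inj₁ eq)))))) (∈-map⁺ pre z∈L))

    killed' : NoOdd (Del (Core H c') L') (suc g)
    killed' u n n≤g odd-n p = noOdd-EU⁻ (ψ u) n n≤g odd-n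
      (mapʷ ψ (λ (e@(_ , cu , cv) , u∉ , v∉) → ψ-hom e , avoids cu u∉ , avoids cv v∉) p)

  -- The copy of `H` completed by `s T` and the j-th copy

  module _ (h≤b : h ≤ b) (G : Graph n) (G₀⊆G : Extends G₀ G) (T : Fin (h ^ d)) (j : Fin d)
    (complete : ∀ z → M x z → z ∉ L → Adj G (enc (inj₁ (inj₁ (sᵛ T)))) (enc (inj₁ (inj₁ (qᵛ j z))))) where

    private
      -- A relation rather than a function, so that adjacency can be checked by matching on two
      -- placements; `h ≤ b` leaves room for every colour class of `c`.
      data Placed (u : Fin h) : V → Set where
        big  : ∀ {i} → lookup c u ≡ just i → Placed u (inj₂ (i , inject≤ u h≤b))
        root : lookup c u ≡ nothing → u ≡ x → Placed u (inj₁ (inj₁ (sᵛ T)))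
        hub  : lookup c u ≡ nothing → u ∈ L → Placed u (inj₁ (inj₁ (wᵛ u)))
        leaf : lookup c u ≡ nothing → u ∉ x ∷ L → Placed u (inj₁ (inj₁ (qᵛ j u)))

      place : ∀ u → ∃ (Placed u)
      place u with lookup c u in cu
      ... | just i  = _ , big cu
      ... | nothing with u Fin.≟ x
      ...   | yes u≡x = _ , root cu u≡x
      ...   | no  u≢x with u ∈? L
      ...     | yes u∈L = _ , hub cu u∈L
      ...     | no  u∉L = _ , leaf cu λ { (here u≡x) → u≢x u≡x ; (there u∈L) → u∉L u∈L }

      placed-unique : ∀ {u v p q} → Placed u p → Placed v q → p ≡ q → u ≡ v
      placed-unique (big _)      (big _)      eq = Fin.inject≤-injective h≤b h≤b _ _
        (cong (λ { (inj₂ (_ , a)) → a ; (inj₁ _) → inject≤ x h≤b }) eq)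
      placed-unique (root _ u≡x) (root _ v≡x) eq = trans u≡x (sym v≡x)
      placed-unique (hub _ _)    (hub _ _)  refl = refl
      placed-unique (leaf _ _)   (leaf _ _) refl = refl

      placed-adj : ∀ {u v p q} → Placed u p → Placed v q → Adj H u v → Adj G (enc p) (enc q)
      placed-adj {p = p} {q} pu pv e = adj pu pv
        where
        old : E p q → Adj G (enc p) (enc q)
        old = G₀⊆G _ _ ∘ E⇒Adj {p} {q}

        adj : Placed _ p → Placed _ q → Adj G (enc p) (enc q)
        adj (big {i} cu) (big {i'} cv) = old λ { refl → proper _ _ i cu cv e }
        adj (big _)      (root _ _)    = old tt
        adj (big _)      (hub _ _)     = old tt
        adj (big _)      (leaf _ _)    = old tt
        adj (root _ _)   (big _)       = old tt
        adj (hub _ _)    (big _)       = old tt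
        adj (leaf _ _)   (big _)       = old tt
        adj (root _ u≡x) (root _ v≡x)  = contradiction e (irrefl H (trans u≡x (sym v≡x)))
        adj (root cu refl) (hub cv v∈) = old ((e , cu , cv) , tt , v∈ , tt)
        adj (hub cu u∈) (root cv refl) = old ((e , cu , cv) , u∈ , tt , tt)
        adj (hub cu u∈)  (hub cv v∈)   = old ((e , cu , cv) , u∈ , v∈ , tt)
        adj (hub cu u∈)  (leaf cv v∉)  = old ((e , cu , cv) , u∈ , v∉ , tt)
        adj (leaf cu u∉) (hub cv v∈)   = old ((e , cu , cv) , u∉ , v∈ , tt)
        adj (leaf cu u∉) (leaf cv v∉)  = old ((e , cu , cv) , u∉ , v∉ , refl)
        adj (root cu refl) (leaf cv v∉) = complete _ (e , cu , cv) (v∉ ∘ there)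
        adj (leaf cu u∉) (root cv refl) = symm G (complete _ (symm H e , cv , cu) (u∉ ∘ there))

    embed : Contains H G
    embed = (λ u → enc (proj₁ (place u))) ,
      (λ {u} {v} eq → placed-unique (proj₂ (place u)) (proj₂ (place v)) (enc-injective eq)) ,
      λ {u} {v} → placed-adj (proj₂ (place u)) (proj₂ (place v))

  -- Minimum degree of the extensions

  private
    Slots : Set
    Slots = Fin s × Fin b ⊎ Fin t

    slots : Fin (s * b + t) ↔ Slots
    slots = ↔-trans Fin.+↔⊎ (Fin.*↔× ⊎-↔ ↔-refl)

    Neighbours : V → Set
    Neighbours v = ∃ λ (f : Slots → V) → Injective _≡_ _≡_ f × (∀ e → E v (f e))

    inCluster : Fin h → Slots → V
    inCluster z (inj₁ a) = inj₂ a
    inCluster z (inj₂ i) = inj₁ (inj₂ (z , i))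

    inCluster-injective : ∀ z → Injective _≡_ _≡_ (inCluster z)
    inCluster-injective z {inj₁ _} {inj₁ _} refl = refl
    inCluster-injective z {inj₂ _} {inj₂ _} refl = refl

    neighbours : ∀ v → Neighbours v
    neighbours (inj₁ (inj₁ a)) = inCluster (class a) , inCluster-injective (class a) ,
      λ { (inj₁ _) → tt ; (inj₂ _) → refl }
    neighbours (inj₁ (inj₂ (z , i))) with κ-neighbour (proj₂ (π-neighbour z))
    ... | w , m , κ≢ = inCluster w , inCluster-injective w ,
      λ { (inj₁ _) → tt
        ; (inj₂ _) → subst (λ y → M (π z) y × κ (π z) ≢ κ y) (sym (π-fix (M-sym m))) (m , κ≢) }
    neighbours (inj₂ (j , _)) = f , f-inj , f-adj
      where
      -- The `b = k * t` slots of the vertex's own class are filled by the clusters of the `k`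
      -- nonzero vertices; the cluster of `zero` takes the remaining `t` slots.
      cell : Fin b → V
      cell a = let z , i = remQuot {k} t a in inj₁ (inj₂ (suc z , i))

      cell-injective : ∀ {a a'} → cell a ≡ cell a' → a ≡ a'
      cell-injective {a} {a'} eq = Injection.injective (↔⇒↣ (Fin.*↔× {k} {t}))
        (cong (λ { (inj₁ (inj₂ (suc z , i))) → z , i ; _ → remQuot {k} t a }) eq)

      f : Slots → V
      f (inj₁ (j' , a)) with j Fin.≟ j'
      ... | yes _ = cell a
      ... | no  _ = inj₂ (j' , a)
      f (inj₂ i) = inj₁ (inj₂ (zero , i))

      f-inj : Injective _≡_ _≡_ f
      f-inj {inj₁ (j₁ , a₁)} {inj₁ (j₂ , a₂)} eq with j Fin.≟ j₁ | j Fin.≟ j₂ | eq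
      ... | yes refl | yes refl | eq' = cong (λ a → inj₁ (j , a)) (cell-injective eq')
      ... | no  _    | no _     | refl = refl
      f-inj {inj₁ (j₁ , a₁)} {inj₂ _} eq with j Fin.≟ j₁ | eq
      ... | yes _ | ()
      ... | no _  | ()
      f-inj {inj₂ _} {inj₁ (j₁ , a₁)} eq with j Fin.≟ j₁ | eq
      ... | yes _ | ()
      ... | no _  | ()
      f-inj {inj₂ _} {inj₂ _} refl = refl

      f-adj : ∀ e → E (inj₂ (j , _)) (f e)
      f-adj (inj₁ (j' , a)) with j Fin.≟ j'
      ... | yes _   = tt
      ... | no j≢j' = j≢j'
      f-adj (inj₂ _) = tt

  minDegree-extension : ∀ G → Extends G₀ G → s * b + t ≤ δ G
  minDegree-extension G G₀⊆G = minDegree G (ℕ.≤-trans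
    (ℕ.≤-reflexive (ℕ.+-comm (s * b) t))
    (ℕ.+-monoˡ-≤ (s * b) (ℕ.≤-trans (ℕ.m≤m+n t (k * t)) (ℕ.m≤n+m (h * t) (h ^ d + (d * h + h)))))) bounded
    where
    bounded : ∀ i → s * b + t ≤ degree G i
    bounded i with neighbours (dec i)
    ... | f , f-inj , f-adj = degree-injection G i (enc ∘ f ∘ Inverse.to slots)
          (λ eq → Injection.injective (↔⇒↣ slots) (f-inj (enc-injective eq)))
          λ a → G₀⊆G _ _ (subst (E (dec i)) (sym (dec-enc _)) (f-adj _))

  -- VC-dimension of the extensions

  private
    sⱽ : Fin (h ^ d) → Fin n
    sⱽ T = enc (inj₁ (inj₁ (sᵛ T)))

    qⱽ : Fin d → Fin h → Fin n
    qⱽ j z = enc (inj₁ (inj₁ (qᵛ j z)))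

    allQ : List (Fin n)
    allQ = map (λ e → let j , z = remQuot {d} h e in qⱽ j z) (allFin (d * h))

  A : Subset n
  A = fromList allQ

  ∣A∣≤dh : ∣ A ∣ ≤ d * h
  ∣A∣≤dh = ℕ.≤-trans (∣fromList∣ allQ)
    (ℕ.≤-reflexive (trans (length-map (λ e → let j , z = remQuot {d} h e in qⱽ j z) (allFin (d * h)))
      (length-tabulate id)))

  q∈A : ∀ j z → qⱽ j z Sub.∈ A
  q∈A j z = subst (λ (j , z) → qⱽ j z Sub.∈ A) (Fin.remQuot-combine j z)
    (∈-fromList (∈-map⁺ _ (∈-allFin (combine j z))))

  -- The trace on A of the vertex s T is a word whose j-th letter, a set of vertices of H, contains
  -- T j but misses some neighbour of x; few traces cannot cover all T.
  VC-extension : ∀ {C} → h ≤ b → suc (d * h) ^ suc C * k ^ d < h ^ d →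
    ∀ G → Extends G₀ G → Free H G → ¬ VC G ≤ C
  VC-extension {C} h≤b few G G₀⊆G G-free VC≤C
    with sauerShelah A (suc C) {λ w → ∃ λ v → N G v ∩ A ≡ w}
           (λ w → Fin.any? λ v → Vec.≡-dec Bool._≟_ (N G v ∩ A) w)
           (λ { (v , refl) → Subₚ.p∩q⊆q (N G v) A })
  ... | inj₁ (S , ∣S∣ , sh) = ℕ.<⇒≱ (shattered≤VC G (S , ∣S∣ , shatters⇒shattered G A S sh)) VC≤C
  ... | inj₂ (ws , len , all) = final
    where
    Missing : Subset n → Fin d → Fin h → Set
    Missing w j y = M x y × y ∉ L × qⱽ j y Sub.∉ w

    missing? : ∀ w j y → Dec (Missing w j y)
    missing? w j y = M? x y ×-dec (¬? (y ∈? L) ×-dec ¬? (qⱽ j y Subₚ.∈? w))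

    misses? : ∀ w → Dec (∀ j → ∃ λ y → Missing w j y)
    misses? w = Fin.all? λ j → Fin.any? (missing? w j)

    few' : length (filter misses? ws) * k ^ d < h ^ d
    few' = ℕ.≤-<-trans (ℕ.*-monoˡ-≤ (k ^ d) (ℕ.≤-trans (length-filter misses? ws) (ℕ.≤-trans len
      (ℕ.≤-trans (sauerBound≤^ ∣ A ∣ (suc C)) (ℕ.^-monoˡ-≤ (suc C) (s≤s ∣A∣≤dh)))))) few

    module _ (T : Fin d → Fin h)
      (hit : ∀ {w} → w ∈ filter misses? ws → ∃ λ j → ¬ ¬ Missing w j (T j)) where

      code : Fin (h ^ d)
      code = funToFin T

      trace : Subset n
      trace = N G (sⱽ code) ∩ A

      -- Otherwise `s T` would see all it needs in the j-th copy, and `embed` would produce a copy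
      -- of `H`.
      trace-misses : ∀ j → ∃ λ y → Missing trace j y
      trace-misses j with Fin.any? (missing? trace j)
      ... | yes mis = mis
      ... | no none = contradiction (embed h≤b G G₀⊆G code j λ z m z∉L → decidable-stable (adj? G _ _)
              λ ¬e → none (z , m , z∉L , λ q∈ → ¬e (∈-N⁻ G (proj₁ (Subₚ.x∈p∩q⁻ _ _ q∈))))) G-free

      T∈trace : ∀ j → M x (T j) → T j ∉ L → qⱽ j (T j) Sub.∈ trace
      T∈trace j m Tj∉L = Subₚ.x∈p∩q⁺ (∈-N G (G₀⊆G _ _ (E⇒Adj
        {inj₁ (inj₁ (sᵛ code))} {inj₁ (inj₁ (qᵛ j (T j)))}
        (m , tt , (λ { (here eq) → M-irrefl (subst (M x) eq m) ; (there Tj∈L) → Tj∉L Tj∈L }) ,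
         sym (Fin.finToFun-funToFin T j)))) , q∈A j (T j))

      uncovered-absurd : ⊥
      uncovered-absurd with hit (∈-filter⁺ misses? (all (sⱽ code , refl)) trace-misses)
      ... | j , ¬¬missing = ¬¬missing λ (m , Tj∉L , q∉) → q∉ (T∈trace j m Tj∉L)

    final : ⊥
    -- A letter counts as admissible when it is not missing; each filtered trace has an inadmissible
    -- letter at every position, so it covers at most `k ^ d` words.
    final with uncoveredWord d {λ w j y → ¬ Missing w j y} (λ w j y → ¬? (missing? w j y))
                 (filter misses? ws)
                 (λ w∈ j → let y , mis = proj₂ (∈-filter⁻ misses? {xs = ws} w∈) j in y , λ ok → ok mis)
                 few'
    ... | T , hit = uncovered-absurd T hit

-- The minimum degree condition

-- t ≥ |p| n₀ absorbs the n₀ extra vertices, because p < a / b gives 1 + ↥p b ≤ a ↧p.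
clearDenominators : ∀ p a b n₀ t → p ℚ.< + a / suc b → ℤ.∣ ℚ.↥ p ∣ * n₀ ≤ t →
  p ℚ.* (+ (n₀ + t * suc b) / 1) ℚ.≤ + (t * a) / 1
clearDenominators p@(ℚ.mkℚ _ _ _) a b n₀ t p<a/b large = ℚ.toℚᵘ-cancel-≤
  (ℚᵘ.≤-respʳ-≃ (ℚᵘ.≃-sym (ℚ.toℚᵘ-fromℚᵘ (mkℚᵘ (+ (t * a)) 0)))
    (ℚᵘ.≤-respˡ-≃ (ℚᵘ.≃-sym lhs) (ℚᵘ.*≤* core)))
  where
  P Q : ℤ
  P = ℚ.↥ p
  Q = ℚ.↧ p

  lhs : toℚᵘ (p ℚ.* (+ (n₀ + t * suc b) / 1)) ℚᵘ.≃ toℚᵘ p ℚᵘ.* mkℚᵘ (+ (n₀ + t * suc b)) 0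
  lhs = ℚᵘ.≃-trans (ℚ.toℚᵘ-homo-* p (+ (n₀ + t * suc b) / 1))
    (ℚᵘ.*-congˡ {toℚᵘ p} (ℚ.toℚᵘ-fromℚᵘ (mkℚᵘ (+ (n₀ + t * suc b)) 0)))

  P*b<a*Q : P ℤ.* + suc b ℤ.< + a ℤ.* Q
  P*b<a*Q with ℚᵘ.<-respʳ-≃ (ℚ.toℚᵘ-fromℚᵘ (mkℚᵘ (+ a) b)) (ℚ.toℚᵘ-mono-< p<a/b)
  ... | ℚᵘ.*<* lt = lt

  P≤∣P∣ : ∀ i → i ℤ.≤ + ℤ.∣ i ∣
  P≤∣P∣ (+ n)      = ℤ.≤-refl
  P≤∣P∣ (-[1+ n ]) = ℤ.-≤+

  P*n₀≤t : P ℤ.* + n₀ ℤ.≤ + t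
  P*n₀≤t = ℤ.≤-trans (ℤ.*-monoʳ-≤-nonNeg (+ n₀) (P≤∣P∣ P))
    (ℤ.≤-trans (ℤ.≤-reflexive (sym (ℤ.pos-* ℤ.∣ P ∣ n₀))) (ℤ.+≤+ large))

  bound : P ℤ.* + (n₀ + t * suc b) ℤ.≤ + (t * a) ℤ.* Q
  bound = begin
    P ℤ.* + (n₀ + t * suc b)                       ≡⟨ cong (λ m → P ℤ.* (+ n₀ ℤ.+ m)) (ℤ.pos-* t (suc b)) ⟩
    P ℤ.* (+ n₀ ℤ.+ + t ℤ.* + suc b)               ≡⟨ expand P (+ n₀) (+ t) (+ suc b) ⟩
    P ℤ.* + n₀ ℤ.+ + t ℤ.* (P ℤ.* + suc b)         ≤⟨ ℤ.+-monoˡ-≤ _ P*n₀≤t ⟩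
    + t ℤ.+ + t ℤ.* (P ℤ.* + suc b)                ≡⟨ ℤ.*-suc (+ t) (P ℤ.* + suc b) ⟨
    + t ℤ.* ℤ.suc (P ℤ.* + suc b)                  ≤⟨ ℤ.*-monoˡ-≤-nonNeg (+ t) (ℤ.i<j⇒suc[i]≤j P*b<a*Q) ⟩
    + t ℤ.* (+ a ℤ.* Q)                            ≡⟨ ℤ.*-assoc (+ t) (+ a) Q ⟨
    + t ℤ.* + a ℤ.* Q                              ≡⟨ cong (ℤ._* Q) (ℤ.pos-* t a) ⟨
    + (t * a) ℤ.* Q                                ∎
    where
    open ℤ.≤-Reasoning
    expand : ∀ p n t b → p ℤ.* (n ℤ.+ t ℤ.* b) ≡ p ℤ.* n ℤ.+ t ℤ.* (p ℤ.* b)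
    expand = ℤRing.solve-∀

  core : (P ℤ.* + (n₀ + t * suc b)) ℤ.* + 1 ℤ.≤ + (t * a) ℤ.* (Q ℤ.* + 1)
  core = subst₂ ℤ._≤_ (sym (ℤ.*-identityʳ _)) (cong (+ (t * a) ℤ.*_) (sym (ℤ.*-identityʳ Q))) bound

-- The bound on the threshold

L<U : ∀ (γ : ℝ) {p q} → ℝ.L γ p → ℝ.U γ q → p ℚ.< q
L<U γ {p} {q} Lp Uq with ℚ.<-cmp p q
... | tri< p<q _ _  = p<q
... | tri≈ _ refl _ = contradiction Uq (ℝ.disjoint γ Lp)
... | tri> _ _ q<p  = contradiction Uq (ℝ.disjoint γ (ℝ.L-closed γ q<p Lp))

oneVertexColourable : (H : Graph 1) → Colourable H 1
oneVertexColourable H = id , λ { {zero} {zero} e → contradiction e (irrefl H refl) }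

noVertexColourable : (H : Graph 0) → Colourable H 0
noVertexColourable H = id , λ { {()} }

module _ {k s : ℕ} .{{_ : NonZero k}} (H : Graph (suc k)) (¬col : ¬ Colourable H (2 + s)) where

  -- In an edgeless core deleting `L` alone would do, against the minimality of `x ∷ L`.
  coreEdge : (C : Configuration H {s}) → ∃ λ u → ∃ λ v → Core H (Configuration.c C) u v
  coreEdge C = decidable-stable (Fin.any? λ u → Fin.any? λ v → Core? H c u v)
    λ none → minimal c proper girth L refl λ
      { u _ _ ()  []
      ; u _ _ odd (((e , _) ∷ _)) → none (_ , _ , e) }
    where open Configuration C

  unboundedVC : ∀ C {p} → p ℚ.< + (s * k + 1) / suc (suc s * k) →
    ¬ (∀ {n} (G : Graph n) → MaximalFree H G → p ℚ.* (+ n / 1) ℚ.≤ + δ G / 1 → VC G ≤ C)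
  unboundedVC C {p} p<bound bounded = configuration H ¬col contra
    where
    d   = proj₁ (manyWords k (suc k) (suc C))
    few = proj₂ (manyWords k (suc k) (suc C))

    n₀ t : ℕ
    n₀ = suc k ^ d + (d * suc k + suc k)
    -- The summand `suc k` ensures `h ≤ b`; the other absorbs the `n₀` vertices of `F`.
    t  = suc k + ℤ.∣ ℚ.↥ p ∣ * n₀

    contra : ¬ Configuration H {s}
    contra conf = maximalExtension H G₀ free λ (G , G₀⊆G , max) →
      VC-extension (ℕ.≤-trans (ℕ.m≤m+n (suc k) _) (ℕ.m≤n*m t k)) few G G₀⊆G (MaximalFree.free max)
        (bounded G max (ℚ.≤-trans (subst (λ m → p ℚ.* (+ m / 1) ℚ.≤ + (t * (s * k + 1)) / 1) (size n₀ t k s)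
          (clearDenominators p (s * k + 1) (suc s * k) n₀ t p<bound (ℕ.m≤n+m _ (suc k))))
          (/1-mono (subst (_≤ δ G) (degrees t k s) (minDegree-extension G G₀⊆G)))))
      where
      open Construction H conf d t (proj₁ (coreEdge conf)) (proj₂ (coreEdge conf))

      size : ∀ n₀ t k s → n₀ + t * suc (suc s * k) ≡ (n₀ + suc k * t) + s * (k * t)
      size = solve-∀

      degrees : ∀ t k s → s * (k * t) + t ≡ t * (s * k + 1)
      degrees = solve-∀

      /1-mono : ∀ {m n} → m ≤ n → + m / 1 ℚ.≤ + n / 1
      /1-mono {m} {n} m≤n = ℚ.toℚᵘ-cancel-≤
        (ℚᵘ.≤-respʳ-≃ (ℚᵘ.≃-sym (ℚ.toℚᵘ-fromℚᵘ (mkℚᵘ (+ n) 0)))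
          (ℚᵘ.≤-respˡ-≃ (ℚᵘ.≃-sym (ℚ.toℚᵘ-fromℚᵘ (mkℚᵘ (+ m) 0)))
            (ℚᵘ.*≤* (ℤ.*-monoʳ-≤-nonNeg (+ 1) (ℤ.+≤+ m≤n)))))

  -- A rational `p` with γ < `p` < `q` stands in for the real γ: graphs of minimum degree at least
  -- `p` times their order also meet the condition for γ, and if `q` did not exceed the bound, `p`
  -- would lie below it.
  δVC-bound : fromℚ (+ (s * k + 1) / suc (suc s * k)) ≤ᵁ δVC H
  δVC-bound q (γ , (_ , C , bounded) , γ<q) = decidable-stable (_ ℚ.<? q) λ bound≮q →
    let p , p<q , γ<p = ℝ.U-open γ γ<q in
    unboundedVC C (ℚ.<-≤-trans p<q (ℚ.≮⇒≥ bound≮q)) λ {n} G max p·n≤δ →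
      bounded G max λ q' Lq' → ℚ.≤-trans
        (ℚ.*-monoʳ-≤-nonNeg (+ n / 1) {{ℚ.normalize-nonNeg n 1}} (ℚ.<⇒≤ (L<U γ Lq' γ<p))) p·n≤δ

-- After cross-multiplication the two sides differ by exactly 1.
trivialBound<bound : ∀ k s → + s / suc s ℚ.< + (s * k + 1) / suc (suc s * k)
trivialBound<bound k s = ℚ.toℚᵘ-cancel-<
  (ℚᵘ.<-respʳ-≃ (ℚᵘ.≃-sym (ℚ.toℚᵘ-fromℚᵘ (mkℚᵘ (+ (s * k + 1)) (suc s * k))))
    (ℚᵘ.<-respˡ-≃ (ℚᵘ.≃-sym (ℚ.toℚᵘ-fromℚᵘ (mkℚᵘ (+ s) s))) (ℚᵘ.*<* cross)))
  where
  cross : + s ℤ.* + suc (suc s * k) ℤ.< + (s * k + 1) ℤ.* + suc s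
  cross = subst₂ ℤ._<_ (ℤ.pos-* s _) (ℤ.pos-* (s * k + 1) (suc s))
    (ℤ.+<+ (ℕ.≤-reflexive (identity s k)))
    where
    identity : ∀ s k → suc (s * suc (suc s * k)) ≡ (s * k + 1) * suc s
    identity = solve-∀

theorem1p5 : ∀ {h} (H : Graph h) (r : ℕ) → ChromaticNumber H r → (3≤r : 3 ≤ r) →
    let bound = + ((r ∸ 3) * (h ∸ 1) + 1) / (1 + (r ∸ 2) * (h ∸ 1))
        trivialBound = _/_ (+ (r ∸ 3)) (r ∸ 2) {{r∸2-nonZero 3≤r}}
    in (fromℚ bound ≤ᵁ δVC H) × (trivialBound ℚ.< bound)
-- With at most one vertex the chromatic number is at most 1. In all clauses `s` is `r ∸ 3`.
theorem1p5 {0} H _ χ (s≤s (s≤s (s≤s {n = s} z≤n))) =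
  contradiction (ChromaticNumber.least χ 0 (noVertexColourable H)) λ ()
theorem1p5 {1} H _ χ (s≤s (s≤s (s≤s {n = s} z≤n))) =
  contradiction (ChromaticNumber.least χ 1 (oneVertexColourable H)) λ { (s≤s ()) }
theorem1p5 {suc k@(suc _)} H _ χ (s≤s (s≤s (s≤s {n = s} z≤n))) =
  δVC-bound H (λ col → ℕ.1+n≰n (ChromaticNumber.least χ (2 + s) col)) , trivialBound<bound k s
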